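{- Let $X$ be a sock ordering that is not foot-sortable. Then some subpattern of $X$ belongs to $\Gamma$; that is, there is a subordering $Z\subseteq X$ that is equivalent to one of the sock orderings in the explicit list $\Gamma$ described in the context.
   Context: A sock ordering is a finite word of socks, each sock having a color; we write it as a word over colors, and in a displayed word distinct letters denote distinct colors. Two sock orderings $X=x_1\cdots x_n$ and $Z=z_1\cdots z_n$ are equivalent ($X\cong Z$) if there is a bijection $\varphi$ from the colors of $X$ to the colors of $Z$ with $\varphi(x_i)=z_i$ for all $i$. $Y\subseteq X$ ($Y$ is a subordering of $X$) if $Y$ is obtained from $X$ by deleting zero or more socks; $Y$ is a subpattern of $X$ ($Y\preceq X$) if $Z\cong Y$ for some $Z\subseteq X$. Foot-sorting: a state is a pair $(S,R)$, where $S$ is the content of a stack (read left to right = bottom to top) and $R$ is the remaining input. One step either pushes the leftmost sock of $R$ onto the top of the stack, or pops the top sock of the stack and appends it to the right end of the output. A state $(S,R)$ is foot-sortable if some sequence of steps reaches $(\emptyset,\emptyset)$ with an output in which all socks of each color are consecutive; otherwise it is unsortable. A sock ordering $X$ is foot-sortable iff $(\emptyset,X)$ is. For a sequence $(t_0,\dots,t_n)$ of distinct colors, $I(t_0)$ is the empty word and, for $n\ge1$, $I(t_0,\dots,t_n)=I(t_0,\dots,t_{n-1})\,t_nt_{n-1}=t_1t_0t_2t_1\cdots t_nt_{n-1}$. $\Gamma$ is the set of all sock orderings equivalent to one of the following: (i) $abacaba$, $abacbab$, $abcabca$, $abcacba$, $abcabac$, $abcbacb$, $abcbabc$, $abcadcab$,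 $abacdcba$, $abacdcab$; (ii) $datdarat$, $atdtarat$, $atdatrat$, $adtdarat$, $atdedarat$, $atdtrart$, $datdrart$, $adtdrart$, $atdedrart$, $atdtarbrt$, $adtdarbrt$, $datdarbrt$, $atdedarbrt$; (iii) $abtdatab$, $abtdtatb$, $adbtdabt$, $adbtdatb$, $abdtdatb$, $abtdedabt$, $abtdedatb$; (iv) for every $n\ge 0$ and distinct colors $a,b,d,e,t_0,\dots,t_n$, with $t=t_0$ and $E=I(t_0,\dots,t_n)\,a\,t_n$ (so $E=at_0$ when $n=0$): $I_{1,n}=dabtdE$, $I_{2,n}=adbtdbE$, $I_{3,n}=abdtdbE$, $I_{4,n}=abtdtbE$, $I_{5,n}=abtdedbE$. -}

module Defs where

open import Data.Nat using (ℕ; zero; suc; _+_)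
open import Data.List using (List; []; _∷_; _++_; [_]; map)
open import Data.List.Membership.Propositional using (_∈_)
open import Data.List.Relation.Unary.All using (All)
open import Data.List.Relation.Unary.Any using (Any)
open import Data.List.Relation.Binary.Sublist.Propositional using (_⊆_) public
open import Data.Product using (Σ; _×_; ∃)
open import Data.Sum using (_⊎_)
open import Data.String using (String; toList)
open import Data.Char using (toℕ)
open import Relation.Binary.PropositionalEquality using (_≡_)
open import Relation.Nullary using (¬_)

Color : Set
Color = ℕ

SockOrdering : Set
SockOrdering = List Color

-- X ≅ Z : there is a map φ on colours, injective on the colours occurring in X
-- (hence a bijection from the colours of X onto the colours of Z), with
-- φ(x_i) = z_i for all i.
_≅_ : SockOrdering → SockOrdering → Set
X ≅ Z = Σ (Color → Color) λ φ →
          (∀ {u v} → u ∈ X → v ∈ X → φ u ≡ φ v → u ≡ v) × (map φ X ≡ Z)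

_≼_ : SockOrdering → SockOrdering → Set
Y ≼ X = Σ SockOrdering λ Z → (Z ⊆ X) × (Z ≅ Y)

Consecutive : SockOrdering → Set
Consecutive F = ∀ (A B C : SockOrdering) (c : Color) →
  F ≡ A ++ (c ∷ B ++ (c ∷ C)) → All (c ≡_) B

-- Foot-sorting runs.  Runs S R O F : from the state with stack S (written TOP FIRST),
-- remaining input R and output produced so far O, some sequence of steps reaches
-- the state (∅,∅) with final output F.
data Runs : SockOrdering → SockOrdering → SockOrdering → SockOrdering → Set where
  done : ∀ {F} → Runs [] [] F F
  push : ∀ {S r R O F} → Runs (r ∷ S) R O F → Runs S (r ∷ R) O F
  pop  : ∀ {s S R O F} → Runs S R (O ++ [ s ]) F → Runs (s ∷ S) R O F

FootSortable : SockOrdering → Set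
FootSortable X = Σ SockOrdering λ F → Runs [] X [] F × Consecutive F

w : String → SockOrdering
w s = map toℕ (toList s)

ΓFinite : List SockOrdering
ΓFinite =
  w "abacaba" ∷ w "abacbab" ∷ w "abcabca" ∷ w "abcacba" ∷ w "abcabac" ∷
  w "abcbacb" ∷ w "abcbabc" ∷ w "abcadcab" ∷ w "abacdcba" ∷ w "abacdcab" ∷
  w "datdarat" ∷ w "atdtarat" ∷ w "atdatrat" ∷ w "adtdarat" ∷ w "atdedarat" ∷
  w "atdtrart" ∷ w "datdrart" ∷ w "adtdrart" ∷ w "atdedrart" ∷ w "atdtarbrt" ∷
  w "adtdarbrt" ∷ w "datdarbrt" ∷ w "atdedarbrt" ∷
  w "abtdatab" ∷ w "abtdtatb" ∷ w "adbtdabt" ∷ w "adbtdatb" ∷ w "abdtdatb" ∷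
  w "abtdedabt" ∷ w "abtdedatb" ∷ []

ca cb cd ce : Color
ca = 0
cb = 1
cd = 2
ce = 3

tt : ℕ → Color
tt i = 4 + i

I : ℕ → SockOrdering
I zero    = []
I (suc n) = I n ++ (tt (suc n) ∷ tt n ∷ [])

E : ℕ → SockOrdering
E n = I n ++ (ca ∷ tt n ∷ [])

ΓFamily : ℕ → List SockOrdering
ΓFamily n =
  (cd ∷ ca ∷ cb ∷ tt 0 ∷ cd ∷ E n) ∷
  (ca ∷ cd ∷ cb ∷ tt 0 ∷ cd ∷ cb ∷ E n) ∷
  (ca ∷ cb ∷ cd ∷ tt 0 ∷ cd ∷ cb ∷ E n) ∷
  (ca ∷ cb ∷ tt 0 ∷ cd ∷ tt 0 ∷ cb ∷ E n) ∷
  (ca ∷ cb ∷ tt 0 ∷ cd ∷ ce ∷ cd ∷ cb ∷ E n) ∷ []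

InΓ : SockOrdering → Set
InΓ Y = Any (Y ≅_) ΓFinite ⊎ Σ ℕ λ n → Any (Y ≅_) (ΓFamily n)

-- A state consists of a stack, with runs of equal socks contracted, and an input. A colour
-- c on the stack can be output completely iff it is on top and pushing all other socks up
-- to the last c creates no sandwich xyx; it may be kept on the stack until a cut, i.e. a
-- position of the input across which no other colour extends. Hence the first sock m of X
-- leaves two choices: output it at once, or keep it at the bottom. In either case, once two
-- colours of the stack recur in the input, all further moves are forced: if a is the lowest
-- of them, then everything above a has to be output before the next a, except that the
-- output of one colour u extending across that a may have begun; continuing with u is a
-- smaller instance of the same situation. When a forced move is impossible, a bounded part
-- of X is responsible for it, together with one connection that may be long: that a
-- colour b under t cannot be output before the next a is witnessed by a chain of overlapping
-- colours from t to a, and choosing each colour of the chain to last as long as possible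
-- yields the word E. The bounded parts are covered by finitely many templates, checked by
-- evaluation.

{-# OPTIONS --safe #-}
module Submission where

open import Defs
open import Data.Bool using (Bool; true; false; T; _∧_; _∨_; if_then_else_)
open import Data.Bool.ListAction using (all; any)
open import Data.Bool.Properties using (T-∧; T-∨)
open import Data.Empty using (⊥; ⊥-elim)
open import Data.List
  using (List; []; _∷_; _++_; [_]; map; concat; concatMap; length; reverse; upTo)
open import Data.List.Membership.Propositional using (_∈_; _∉_; lose; find)
open import Data.List.Membership.Propositional.Properties
  using (∈-map⁺; ∈-map⁻; ∈-++⁺ˡ; ∈-++⁺ʳ; ∈-++⁻; ∈-concat⁺′; ∈-∃++; ∈-upTo⁻)
open import Data.List.Properties
  using (map-++; map-∘; map-id; ++-assoc; ++-identityʳ; length-++; unfold-reverse;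
         reverse-++; reverse-involutive)
open import Data.List.Relation.Binary.Pointwise using (Pointwise; []; _∷_)
open import Data.List.Relation.Binary.Sublist.Propositional
  using ([]; _∷_; _∷ʳ_; ⊆-refl; ⊆-reflexive; ⊆-trans; minimum; from∈; lookup)
open import Data.List.Relation.Binary.Sublist.Propositional.Properties
  using (++⁺; ++⁺ˡ; ++⁺ʳ; ∷ˡ⁻; map⁺; length-mono-≤)
open import Data.List.Relation.Unary.All as All using (All; []; _∷_)
import Data.List.Relation.Unary.All.Properties as All
open import Data.List.Relation.Unary.AllPairs using ([]; _∷_)
open import Data.List.Relation.Unary.Any as Any using (Any; here; there)
open import Data.List.Relation.Unary.Any.Properties using (reverse⁺; reverse⁻)
open import Data.List.Relation.Unary.Unique.Propositional using (Unique)
import Data.List.Relation.Unary.Unique.Propositional.Properties as Unique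
open import Data.Maybe using (Maybe; just; nothing)
open import Data.Nat
  using (ℕ; zero; suc; _+_; _∸_; _≤_; _<_; z≤n; s≤s; s≤s⁻¹; _≟_; _≡ᵇ_)
open import Data.Nat.ListAction using (sum)
open import Data.Nat.Properties
  using (≤-refl; ≤-trans; ≤-reflexive; m≤n+m; m≤m+n; n≤1+n; <-irrefl; +-suc; +-comm;
         +-identityʳ; +-mono-≤; +-monoʳ-≤; ≡ᵇ⇒≡; ≡⇒≡ᵇ)
open import Data.List.Membership.DecPropositional _≟_ using (_∈?_)
open import Data.Product using (Σ; ∃; ∃₂; _×_; _,_; proj₁; proj₂; map₂)
import Data.Product as Product
open import Data.Sum using (_⊎_; inj₁; inj₂; [_,_]′)
open import Function using (_∘_; id; Equivalence)
open import Relation.Binary.PropositionalEquality hiding ([_])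
open import Relation.Nullary using (¬_; Dec; yes; no)
open import Relation.Nullary.Decidable using (¬?; _×-dec_)

-- The proof is a simultaneous induction on the number of socks: `Theorem` speaks of words, `Claim`
-- of states reached while one colour `m` was being output. A bare stack carries too little for this
-- induction: a forbidden subpattern must be found in the word, and only the two socks `m` around
-- the pushed colours show there why these had to be stacked. Each appeal to the induction
-- hypothesis concerns a word that embeds in the given one, so a pattern found there transfers at
-- once, whereas sortings of the parts must be glued. Gluing takes place at cuts, across which one
-- colour may have to stay on the stack; hence a run may end with a nonempty stack, and `postpone`
-- turns a complete sorting into a run that keeps its bottom colour.

either : ∀ {A B C : Set} → A ⊎ B → (A → C) → (B → C) → C
either s f g = [ f , g ]′ s

Has : SockOrdering → Set
Has X = Σ SockOrdering λ Z → (Z ⊆ X) × InΓ Z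

has-mono : ∀ {X Y} → X ⊆ Y → Has X → Has Y
has-mono X⊆Y (Z , Z⊆X , γ) = Z , ⊆-trans Z⊆X X⊆Y , γ

-- Deciding pattern occurrence in concrete words

Matching : List (ℕ × ℕ) → Set
Matching ps = ∀ {p q} → p ∈ ps → q ∈ ps →
  (proj₁ p ≡ proj₁ q → proj₂ p ≡ proj₂ q) × (proj₂ p ≡ proj₂ q → proj₁ p ≡ proj₁ q)

-- `_≅_` asks for a total map on colours, so the partial injection given by the pairs is extended by
-- the identity.
backward : List (ℕ × ℕ) → Color → Color
backward [] c = c
backward ((x , y) ∷ ps) c with y ≟ c
... | yes _ = x
... | no _ = backward ps c

backward-∈ : ∀ ps {c} → c ∈ map proj₂ ps → (backward ps c , c) ∈ ps
backward-∈ ((x , y) ∷ ps) {c} c∈ with y ≟ c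
... | yes refl = here refl
... | no y≢c with c∈
...   | here refl = ⊥-elim (y≢c refl)
...   | there c∈′ = there (backward-∈ ps c∈′)

matching-≅ : ∀ ps → Matching ps → map proj₂ ps ≅ map proj₁ ps
matching-≅ ps m = backward ps , injective , go ps id
  where
  injective : ∀ {u v} → u ∈ map proj₂ ps → v ∈ map proj₂ ps →
    backward ps u ≡ backward ps v → u ≡ v
  injective u∈ v∈ = proj₁ (m (backward-∈ ps u∈) (backward-∈ ps v∈))
  go : ∀ qs → (∀ {q} → q ∈ qs → q ∈ ps) → map (backward ps) (map proj₂ qs) ≡ map proj₁ qs
  go [] _ = refl
  go ((x , y) ∷ qs) qs⊆ = cong₂ _∷_
    (proj₂ (m (backward-∈ ps (∈-map⁺ proj₂ (qs⊆ (here refl)))) (qs⊆ (here refl))) refl)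
    (go qs (qs⊆ ∘ there))

compatible : ℕ → ℕ → List (ℕ × ℕ) → Bool
compatible x y [] = true
compatible x y ((x′ , y′) ∷ ps) =
  (if x ≡ᵇ x′ then y ≡ᵇ y′ else (if y ≡ᵇ y′ then false else true)) ∧ compatible x y ps

-- The first argument bounds the number of letters of the word that may be skipped.
match : ℕ → List ℕ → List ℕ → List (ℕ × ℕ) → Bool
match s [] w ps = true
match s (x ∷ p) [] ps = false
match zero (x ∷ p) (y ∷ w) ps = compatible x y ps ∧ match zero p w ((x , y) ∷ ps)
match (suc s) (x ∷ p) (y ∷ w) ps =
  (compatible x y ps ∧ match (suc s) p w ((x , y) ∷ ps)) ∨ match s (x ∷ p) w ps

T-∧⁻ : ∀ {x y} → T (x ∧ y) → T x × T y
T-∧⁻ = Equivalence.to T-∧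

T-∨⁻ : ∀ {x y} → T (x ∨ y) → T x ⊎ T y
T-∨⁻ = Equivalence.to T-∨

compatible-sound : ∀ x y ps → T (compatible x y ps) → ∀ {q} → q ∈ ps →
  (x ≡ proj₁ q → y ≡ proj₂ q) × (y ≡ proj₂ q → x ≡ proj₁ q)
compatible-sound x y ((x′ , y′) ∷ ps) c (there q∈) =
  compatible-sound x y ps (proj₂ (T-∧⁻ c)) q∈
compatible-sound x y ((x′ , y′) ∷ ps) c (here refl) =
  go (proj₁ (T-∧⁻ c))
  where
  go : T (if x ≡ᵇ x′ then y ≡ᵇ y′ else (if y ≡ᵇ y′ then false else true)) →
    (x ≡ x′ → y ≡ y′) × (y ≡ y′ → x ≡ x′)
  go t with x ≡ᵇ x′ in eqx | y ≡ᵇ y′ in eqy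
  ... | true | true = (λ _ → ≡ᵇ⇒≡ y y′ (subst T (sym eqy) _)) ,
                      (λ _ → ≡ᵇ⇒≡ x x′ (subst T (sym eqx) _))
  ... | false | false = (λ e → ⊥-elim (subst T eqx (≡⇒≡ᵇ x x′ e))) ,
                        (λ e → ⊥-elim (subst T eqy (≡⇒≡ᵇ y y′ e)))
  ... | false | true = ⊥-elim t

matching-∷ : ∀ {x y} ps → T (compatible x y ps) → Matching ps → Matching ((x , y) ∷ ps)
matching-∷ ps c m (here refl) (here refl) = (λ _ → refl) , (λ _ → refl)
matching-∷ ps c m (here refl) (there q∈) = compatible-sound _ _ ps c q∈
matching-∷ ps c m (there p∈) (here refl) =
  (λ e → sym (proj₁ (compatible-sound _ _ ps c p∈) (sym e))) ,
  (λ e → sym (proj₂ (compatible-sound _ _ ps c p∈) (sym e)))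
matching-∷ ps c m (there p∈) (there q∈) = m p∈ q∈

Matched : List ℕ → List ℕ → List (ℕ × ℕ) → Set
Matched p w ps = ∃ λ qs → map proj₁ qs ≡ p × map proj₂ qs ⊆ w × Matching (qs ++ ps)

matched-∷ : ∀ {x y p w ps} → Matched p w ((x , y) ∷ ps) → Matched (x ∷ p) (y ∷ w) ps
matched-∷ {x} {y} {ps = ps} (qs , eq , sub , m) =
  (x , y) ∷ qs , cong (x ∷_) eq , refl ∷ sub , λ p∈ q∈ → m (swap p∈) (swap q∈)
  where
  swap : ∀ {p} → p ∈ ((x , y) ∷ qs) ++ ps → p ∈ qs ++ ((x , y) ∷ ps)
  swap (here refl) = ∈-++⁺ʳ qs (here refl)
  swap (there p∈) with ∈-++⁻ qs p∈
  ... | inj₁ i = ∈-++⁺ˡ i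
  ... | inj₂ i = ∈-++⁺ʳ qs (there i)

match-sound : ∀ s p w ps → T (match s p w ps) → Matching ps → Matched p w ps
match-sound s [] w ps _ m = [] , refl , minimum w , m
match-sound zero (x ∷ p) (y ∷ w) ps t m with T-∧⁻ {compatible x y ps} t
... | c , t′ = matched-∷ (match-sound zero p w _ t′ (matching-∷ ps c m))
match-sound (suc s) (x ∷ p) (y ∷ w) ps t m
  with T-∨⁻ {compatible x y ps ∧ match (suc s) p w ((x , y) ∷ ps)} t
... | inj₂ t′ with match-sound s (x ∷ p) w ps t′ m
...   | qs , eq , sub , m′ = qs , eq , y ∷ʳ sub , m′
match-sound (suc s) (x ∷ p) (y ∷ w) ps t m | inj₁ t′ with T-∧⁻ {compatible x y ps} t′
... | c , t″ = matched-∷ (match-sound (suc s) p w _ t″ (matching-∷ ps c m))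

InjectiveOn : (ℕ → Color) → List ℕ → Set
InjectiveOn env xs = ∀ {x y} → x ∈ xs → y ∈ xs → env x ≡ env y → x ≡ y

-- Of the infinite families only the words with n = 0 take part in evaluation; longer ones arise
-- solely from chains built explicitly.
patterns : List SockOrdering
patterns = ΓFinite ++ ΓFamily 0

patterns-InΓ : ∀ {p Z} → p ∈ patterns → Z ≅ p → InΓ Z
patterns-InΓ p∈ iso with ∈-++⁻ ΓFinite p∈
... | inj₁ p∈F = inj₁ (lose p∈F iso)
... | inj₂ p∈I = inj₂ (0 , lose p∈I iso)

any-sound : ∀ {A : Set} (f : A → Bool) xs → T (any f xs) → ∃ λ x → x ∈ xs × T (f x)
any-sound f (x ∷ xs) t with T-∨⁻ {f x} t
... | inj₁ t′ = x , here refl , t′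
... | inj₂ t′ with any-sound f xs t′
...   | y , y∈ , t″ = y , there y∈ , t″

all-sound : ∀ {A : Set} (f : A → Bool) xs → T (all f xs) → ∀ {x} → x ∈ xs → T (f x)
all-sound f (x ∷ xs) t (here refl) = proj₁ (T-∧⁻ {f x} t)
all-sound f (x ∷ xs) t (there i) = all-sound f xs (proj₂ (T-∧⁻ {f x} t)) i

-- An embedding of `p` leaves out `length w ∸ length p` letters of `w`, so this bound loses no
-- embedding and cuts the search early.
embeds : List ℕ → SockOrdering → Bool
embeds w p = match (length w ∸ length p) p w []

hasᵇ : List SockOrdering → List ℕ → Bool
hasᵇ pats w = any (embeds w) pats

hasᵇ-sound : ∀ env reps w → InjectiveOn env reps → All (_∈ reps) w →
  T (hasᵇ patterns w) → Has (map env w)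
hasᵇ-sound env reps w inj w⊆ t with any-sound (embeds w) patterns t
... | p , p∈ , t′ with match-sound (length w ∸ length p) p w [] t′ (λ ())
...   | qs , refl , sub , m = map proj₂ qs′ , sub′ , patterns-InΓ p∈ iso
  where
  qs′ = map (map₂ env) qs
  eq₂ : map proj₂ qs′ ≡ map env (map proj₂ qs)
  eq₂ = trans (sym (map-∘ qs)) (map-∘ qs)
  eq₁ : map proj₁ qs′ ≡ map proj₁ qs
  eq₁ = sym (map-∘ qs)
  sub′ : map proj₂ qs′ ⊆ map env w
  sub′ = subst (_⊆ map env w) (sym eq₂) (map⁺ env sub)
  in-reps : ∀ {q} → q ∈ qs → proj₂ q ∈ reps
  in-reps q∈ = All.lookup w⊆ (lookup sub (∈-map⁺ proj₂ q∈))
  m′ : Matching qs′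
  m′ p∈ q∈ with ∈-map⁻ (map₂ env) p∈ | ∈-map⁻ (map₂ env) q∈
  ... | a , a∈ , refl | b , b∈ , refl =
    (λ e → cong env (proj₁ (m (∈-++⁺ˡ a∈) (∈-++⁺ˡ b∈)) e)) ,
    (λ e → proj₂ (m (∈-++⁺ˡ a∈) (∈-++⁺ˡ b∈)) (inj (in-reps a∈) (in-reps b∈) e))
  iso : map proj₂ qs′ ≅ map proj₁ qs
  iso = subst (map proj₂ qs′ ≅_) eq₁ (matching-≅ qs′ m′)

-- Templates and their certification

-- If the two words start with the same letter, its two positions may be taken to agree:
-- move the later one to the earlier one.
merge : List ℕ → List ℕ → List (List ℕ)
merge [] ys = [ ys ]
merge (x ∷ xs) [] = [ x ∷ xs ]
merge (x ∷ xs) (y ∷ ys) =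
  if x ≡ᵇ y
  then map (x ∷_) (merge xs ys)
  else map (x ∷_) (merge xs (y ∷ ys)) ++ map (y ∷_) (merge (x ∷ xs) ys)

mergeAll : List (List ℕ) → List (List ℕ)
mergeAll [] = [ [] ]
mergeAll (w ∷ ws) = concatMap (merge w) (mergeAll ws)

-- A template: consecutive blocks, each containing the listed words.
Template : Set
Template = List (List (List ℕ))

expand : Template → List (List ℕ)
expand [] = [ [] ]
expand (ws ∷ t) = concatMap (λ u → map (u ++_) (expand t)) (mergeAll ws)

Fits : (ℕ → Color) → Template → List SockOrdering → Set
Fits env = Pointwise (λ ws Z → All (λ w → map env w ⊆ Z) ws)

module _ (env : ℕ → Color) (reps : List ℕ) (inj : InjectiveOn env reps) where

  Found : List (List ℕ) → SockOrdering → Set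
  Found us Z = ∃ λ u → u ∈ us × All (_∈ reps) u × map env u ⊆ Z

  found-∷ : ∀ {x z us Z} → x ∈ reps → env x ≡ z → Found us Z → Found (map (x ∷_) us) (z ∷ Z)
  found-∷ x∈ e (u , u∈ , r , s) = _ , ∈-map⁺ _ u∈ , x∈ ∷ r , e ∷ s

  found-skip : ∀ {z us Z} → Found us Z → Found us (z ∷ Z)
  found-skip {z} (u , u∈ , r , s) = u , u∈ , r , z ∷ʳ s

  found-same : ∀ {x Z} xs ys → Found (map (x ∷_) (merge xs ys)) Z →
    Found (merge (x ∷ xs) (x ∷ ys)) Z
  found-same {x} _ _ f with x ≡ᵇ x | ≡⇒≡ᵇ x x refl
  ... | true | _ = f

  found-left : ∀ {x y Z} xs ys → x ≢ y → Found (map (x ∷_) (merge xs (y ∷ ys))) Z →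
    Found (merge (x ∷ xs) (y ∷ ys)) Z
  found-left {x} {y} xs ys x≢y (u , u∈ , r , s) with x ≡ᵇ y in eq
  ... | true = ⊥-elim (x≢y (≡ᵇ⇒≡ x y (subst T (sym eq) _)))
  ... | false = u , ∈-++⁺ˡ u∈ , r , s

  found-right : ∀ {x y Z} xs ys → x ≢ y → Found (map (y ∷_) (merge (x ∷ xs) ys)) Z →
    Found (merge (x ∷ xs) (y ∷ ys)) Z
  found-right {x} {y} xs ys x≢y (u , u∈ , r , s) with x ≡ᵇ y in eq
  ... | true = ⊥-elim (x≢y (≡ᵇ⇒≡ x y (subst T (sym eq) _)))
  ... | false = u , ∈-++⁺ʳ (map (x ∷_) (merge xs (y ∷ ys))) u∈ , r , s

  merge-found : ∀ xs ys {Z} → All (_∈ reps) xs → All (_∈ reps) ys →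
    map env xs ⊆ Z → map env ys ⊆ Z → Found (merge xs ys) Z
  merge-found [] ys rx ry p q = ys , here refl , ry , q
  merge-found (x ∷ xs) [] rx ry p q = x ∷ xs , here refl , rx , p
  merge-found (x ∷ xs) (y ∷ ys) rx ry (z ∷ʳ p) (_ ∷ʳ q) =
    found-skip (merge-found (x ∷ xs) (y ∷ ys) rx ry p q)
  merge-found (x ∷ xs) (y ∷ ys) (x∈ ∷ rx) (y∈ ∷ ry) (e ∷ p) (_ ∷ʳ q) with x ≟ y
  ... | yes refl = found-same xs ys (found-∷ x∈ e (merge-found xs ys rx ry p (∷ˡ⁻ q)))
  ... | no x≢y = found-left xs ys x≢y (found-∷ x∈ e (merge-found xs (y ∷ ys) rx (y∈ ∷ ry) p q))
  merge-found (x ∷ xs) (y ∷ ys) (x∈ ∷ rx) (y∈ ∷ ry) (_ ∷ʳ p) (e ∷ q) with x ≟ y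
  ... | yes refl = found-same xs ys (found-∷ x∈ e (merge-found xs ys rx ry (∷ˡ⁻ p) q))
  ... | no x≢y = found-right xs ys x≢y (found-∷ y∈ e (merge-found (x ∷ xs) ys (x∈ ∷ rx) ry p q))
  merge-found (x ∷ xs) (y ∷ ys) (x∈ ∷ rx) (y∈ ∷ ry) (e ∷ p) (e′ ∷ q) with x ≟ y
  ... | yes refl = found-same xs ys (found-∷ x∈ e (merge-found xs ys rx ry p q))
  ... | no x≢y = ⊥-elim (x≢y (inj x∈ y∈ (trans e (sym e′))))

  mergeAll-found : ∀ ws {Z} → All (All (_∈ reps)) ws → All (λ w → map env w ⊆ Z) ws →
    Found (mergeAll ws) Z
  mergeAll-found [] _ _ = [] , here refl , [] , minimum _
  mergeAll-found (w ∷ ws) (r ∷ rs) (s ∷ ss) with mergeAll-found ws rs ss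
  ... | u , u∈ , ru , su with merge-found w u r ru s su
  ...   | v , v∈ , rv , sv = v , ∈-concat⁺′ v∈ (∈-map⁺ (merge w) u∈) , rv , sv

  expand-found : ∀ t {Zs} → All (All (All (_∈ reps))) t → Fits env t Zs →
    Found (expand t) (concat Zs)
  expand-found [] _ [] = [] , here refl , [] , []
  expand-found (ws ∷ t) (r ∷ rs) (f ∷ fs) with mergeAll-found ws r f | expand-found t rs fs
  ... | u , u∈ , ru , su | v , v∈ , rv , sv =
    u ++ v ,
    ∈-concat⁺′ (∈-map⁺ (u ++_) v∈) (∈-map⁺ (λ u → map (u ++_) (expand t)) u∈) ,
    All.++⁺ ru rv ,
    subst (_⊆ _) (sym (map-++ env u v)) (++⁺ su sv)

identify : ℕ → ℕ → ℕ → ℕ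
identify i r x = if x ≡ᵇ i then r else x

loop : ℕ × ℕ → Bool
loop (i , j) = i ≡ᵇ j

inᵇ : List ℕ → ℕ → Bool
inᵇ reps x = any (x ≡ᵇ_) reps

identify₂ : ℕ → ℕ → ℕ × ℕ → ℕ × ℕ
identify₂ i r = Product.map (identify i r) (identify i r)

Separated : (ℕ → Color) → ℕ × ℕ → Set
Separated env (x , y) = env x ≢ env y

mutual
  -- Whenever each of the k letters i, …, i+k−1 is identified with an earlier letter or
  -- declared new, in accordance with the disequalities neq, every expansion of t
  -- contains one of the patterns.
  check : List SockOrdering → (k i : ℕ) (reps : List ℕ) → List (ℕ × ℕ) → Template → Bool
  check pats zero i reps neq t =
    all (all (all (inᵇ reps))) t ∧ all (hasᵇ pats) (expand t)
  check pats (suc k) i reps neq t =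
    all (checkOld pats k i reps neq t) reps ∧ check pats k (suc i) (i ∷ reps) neq t

  -- An identification that turns a recorded disequality into a loop cannot occur and is passed
  -- over.
  checkOld : List SockOrdering → (k i : ℕ) (reps : List ℕ) → List (ℕ × ℕ) → Template → ℕ → Bool
  checkOld pats k i reps neq t r =
    any loop (map (identify₂ i r) neq)
    ∨ check pats k (suc i) reps (map (identify₂ i r) neq) (map (map (map (identify i r))) t)

all-All : ∀ {A : Set} {P : A → Set} {f : A → Bool} → (∀ x → T (f x) → P x) →
  ∀ xs → T (all f xs) → All P xs
all-All h [] _ = []
all-All {f = f} h (x ∷ xs) t = h x (proj₁ (T-∧⁻ {f x} t)) ∷ all-All h xs (proj₂ (T-∧⁻ {f x} t))

inᵇ-sound : ∀ reps x → T (inᵇ reps x) → x ∈ reps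
inᵇ-sound reps x t with any-sound (x ≡ᵇ_) reps t
... | y , y∈ , e = subst (_∈ reps) (sym (≡ᵇ⇒≡ x y e)) y∈

module _ (env : ℕ → Color) {i r : ℕ} (same : env r ≡ env i) where

  env-identify : ∀ x → env (identify i r x) ≡ env x
  env-identify x with x ≡ᵇ i in eq
  ... | true = trans same (cong env (sym (≡ᵇ⇒≡ x i (subst T (sym eq) _))))
  ... | false = refl

  no-loop : ∀ ps → All (Separated env) ps → T (any loop (map (identify₂ i r) ps)) → ⊥
  no-loop ((x , y) ∷ ps) (n ∷ ns) l with T-∨⁻ {loop (identify₂ i r (x , y))} l
  ... | inj₁ l′ = n (trans (sym (env-identify x))
                      (trans (cong env (≡ᵇ⇒≡ (identify i r x) (identify i r y) l′))
                          (env-identify y)))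
  ... | inj₂ l′ = no-loop ps ns l′

  separated-identify : ∀ {ps} → All (Separated env) ps →
    All (Separated env) (map (identify₂ i r) ps)
  separated-identify ns = All.map⁺ (All.map
    (λ {p} n e → n (trans (sym (env-identify (proj₁ p))) (trans e (env-identify (proj₂ p))))) ns)

  map-identify : ∀ w → map env (map (identify i r) w) ≡ map env w
  map-identify [] = refl
  map-identify (x ∷ w) = cong₂ _∷_ (env-identify x) (map-identify w)

  fits-identify : ∀ t {Zs} → Fits env t Zs → Fits env (map (map (map (identify i r))) t) Zs
  fits-identify [] [] = []
  fits-identify (ws ∷ t) (f ∷ fs) =
    All.map⁺ (All.map (λ {w} s → subst (_⊆ _) (sym (map-identify w)) s) f) ∷ fits-identify t fs

injectiveOn-∷ : ∀ env {reps i} → InjectiveOn env reps → ¬ Any (λ r → env r ≡ env i) reps →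
  InjectiveOn env (i ∷ reps)
injectiveOn-∷ env inj new (here refl) (here refl) _ = refl
injectiveOn-∷ env inj new (here refl) (there y∈) e = ⊥-elim (new (lose y∈ (sym e)))
injectiveOn-∷ env inj new (there x∈) (here refl) e = ⊥-elim (new (lose x∈ e))
injectiveOn-∷ env inj new (there x∈) (there y∈) e = inj x∈ y∈ e

-- `check` evaluates all admissible partitions of the letters; the proof follows the single
-- partition that the actual colours realise.
check-sound : ∀ env k i reps neq t {Zs} → T (check patterns k i reps neq t) →
  InjectiveOn env reps → All (Separated env) neq → Fits env t Zs → Has (concat Zs)
check-sound env zero i reps neq t c inj _ fits
  with T-∧⁻ {all (all (all (inᵇ reps))) t} c
... | c₁ , c₂ with expand-found env reps inj t
                     (all-All (all-All (all-All (inᵇ-sound reps))) t c₁) fits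
...   | u , u∈ , ru , su =
  has-mono su (hasᵇ-sound env reps u inj ru (all-sound (hasᵇ patterns) (expand t) c₂ u∈))
check-sound env (suc k) i reps neq t c inj ne fits
  with T-∧⁻ {all (checkOld patterns k i reps neq t) reps} c
... | c₁ , c₂ with Any.any? (λ r → env r ≟ env i) reps
...   | no new =
  check-sound env k (suc i) (i ∷ reps) neq t c₂ (injectiveOn-∷ env inj new) ne fits
...   | yes old with find old
...     | r , r∈ , e with T-∨⁻ {any loop (map (identify₂ i r) neq)}
                           (all-sound (checkOld patterns k i reps neq t) reps c₁ r∈)
...       | inj₁ l = ⊥-elim (no-loop env e neq ne l)
...       | inj₂ c′ = check-sound env k (suc i) reps _ _ c′ inj
                        (separated-identify env e ne) (fits-identify env e t fits)

nth : List Color → ℕ → Color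
nth [] _ = 0
nth (c ∷ cs) zero = c
nth (c ∷ cs) (suc i) = nth cs i

-- One argument for all finite cases: if the words of the template fit into consecutive
-- parts of a sock ordering, then some pattern occurs, however the colours and positions
-- that the template leaves open coincide.
certificate : (cs : List Color) (neq : List (ℕ × ℕ)) (t : Template) →
  {T (check patterns (length cs) 0 [] neq t)} →
  All (Separated (nth cs)) neq →
  ∀ {Zs} → Fits (nth cs) t Zs → Has (concat Zs)
certificate cs neq t {c} ne fits =
  check-sound (nth cs) (length cs) 0 [] neq t c (λ ()) ne fits

-- The infinite families with arbitrary colours

∈≤sum : ∀ {x} xs → x ∈ xs → x ≤ sum xs
∈≤sum (x ∷ xs) (here refl) = m≤m+n x (sum xs)
∈≤sum (y ∷ xs) (there x∈) = ≤-trans (∈≤sum xs x∈) (m≤n+m (sum xs) y)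

fresh : ∀ xs → ∃ λ (e : Color) → e ∉ xs
fresh xs = suc (sum xs) , λ e∈ → <-irrefl refl (∈≤sum xs e∈)

nth-∈ : ∀ cs {i} → i < length cs → nth cs i ∈ cs
nth-∈ (c ∷ cs) {zero} _ = here refl
nth-∈ (c ∷ cs) {suc i} (s≤s i<) = there (nth-∈ cs i<)

nth-injective : ∀ {cs} → Unique cs → ∀ {i j} → i < length cs → j < length cs →
  nth cs i ≡ nth cs j → i ≡ j
nth-injective (_ ∷ u) {zero} {zero} _ _ _ = refl
nth-injective {c ∷ cs} (c∉ ∷ u) {zero} {suc j} _ (s≤s j<) e =
  ⊥-elim (All.lookup c∉ (nth-∈ cs j<) e)
nth-injective {c ∷ cs} (c∉ ∷ u) {suc i} {zero} (s≤s i<) _ e =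
  ⊥-elim (All.lookup c∉ (nth-∈ cs i<) (sym e))
nth-injective (_ ∷ u) {suc i} {suc j} (s≤s i<) (s≤s j<) e = cong suc (nth-injective u i< j< e)

-- E = ladder t₀ (t₁ ⋯ tₙ) a.
ladder : Color → List Color → Color → SockOrdering
ladder t [] a = a ∷ t ∷ []
ladder t (t′ ∷ ts) a = t′ ∷ t ∷ ladder t′ ts a

-- `I` grows at its right end, while chains grow from `t` on the left; `E-from k m` is the final
-- part of `E (k + m)` starting with the rung above `tt k`.
E-from : ℕ → ℕ → SockOrdering
E-from k zero = ca ∷ tt k ∷ []
E-from k (suc n) = tt (suc k) ∷ tt k ∷ E-from (suc k) n

I-++-E-from : ∀ n m → I n ++ E-from n m ≡ E-from 0 (n + m)
I-++-E-from zero m = refl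
I-++-E-from (suc n) m = trans (++-assoc (I n) _ _)
  (trans (I-++-E-from n (suc m)) (cong (E-from 0) (+-suc n m)))

E≡E-from : ∀ n → E n ≡ E-from 0 n
E≡E-from n = trans (I-++-E-from n 0) (cong (E-from 0) (+-identityʳ n))

E-from-< : ∀ k n → All (_< 5 + (k + n)) (E-from k n)
E-from-< k zero = s≤s z≤n ∷ s≤s (s≤s (s≤s (s≤s (s≤s (m≤m+n k 0))))) ∷ []
E-from-< k (suc n) =
  subst (λ m → tt (suc k) < 5 + m) (sym (+-suc k n)) (s≤s (s≤s (s≤s (s≤s (s≤s (s≤s (m≤m+n k n)))))))
  ∷ s≤s (s≤s (s≤s (s≤s (s≤s (m≤m+n k (suc n))))))
  ∷ subst (λ m → All (_< 5 + m) (E-from (suc k) n)) (sym (+-suc k n)) (E-from-< (suc k) n)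

E-< : ∀ n → All (_< 5 + n) (E n)
E-< n = subst (All (_< 5 + n)) (sym (E≡E-from n)) (E-from-< 0 n)

map-E-from : ∀ env k t ts → (∀ i → env (tt (k + i)) ≡ nth (t ∷ ts) i) →
  map env (E-from k (length ts)) ≡ ladder t ts (env ca)
map-E-from env k t [] h = cong (λ c → env ca ∷ c ∷ []) (env-tt (h 0))
  where
  env-tt : env (tt (k + 0)) ≡ t → env (tt k) ≡ t
  env-tt = subst (λ m → env (tt m) ≡ t) (+-identityʳ k)
map-E-from env k t (t′ ∷ ts) h = cong₂ _∷_ (subst (λ m → env (tt m) ≡ t′) k+1 (h 1))
  (cong₂ _∷_ (subst (λ m → env (tt m) ≡ t) (+-identityʳ k) (h 0))
    (map-E-from env (suc k) t′ ts (λ i → subst (λ m → env (tt m) ≡ nth (t′ ∷ ts) i) (+-suc k i)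
        (h (suc i)))))
  where
  k+1 : k + 1 ≡ suc k
  k+1 = trans (+-suc k 0) (cong suc (+-identityʳ k))

-- The order of `cs` copies the numbering `ca`, `cb`, `cd`, `ce`, `tt 0`, `tt 1`, and so on, so
-- `nth cs` itself is the renaming of a family word.
module _ (a b d e t : Color) (ts : List Color) (u : Unique (a ∷ b ∷ d ∷ e ∷ t ∷ ts)) where

  private
    cs : List Color
    cs = a ∷ b ∷ d ∷ e ∷ t ∷ ts
    n : ℕ
    n = length ts

  family : ∀ {p} → p ∈ ΓFamily n → All (_< 5 + n) p → Has (map (nth cs) p)
  family {p} p∈ p< = map (nth cs) p , ⊆-refl , inj₂ (n , lose p∈ iso)
    where
    ps : List (ℕ × ℕ)
    ps = map (λ i → i , nth cs i) p
    m : Matching ps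
    m x∈ y∈ with ∈-map⁻ _ x∈ | ∈-map⁻ _ y∈
    ... | i , i∈ , refl | j , j∈ , refl =
      cong (nth cs) , nth-injective u (All.lookup p< i∈) (All.lookup p< j∈)
    iso : map (nth cs) p ≅ p
    iso = subst₂ _≅_ (sym (map-∘ p)) (trans (sym (map-∘ p)) (Data.List.Properties.map-id p))
            (matching-≅ ps m)

  map-E : map (nth cs) (E n) ≡ ladder t ts a
  map-E = trans (cong (map (nth cs)) (E≡E-from n)) (map-E-from (nth cs) 0 t ts (λ _ → refl))

  prefix : ∀ xs → (xs ++ E n) ∈ ΓFamily n → All (_< 5 + n) xs →
    Has (map (nth cs) xs ++ ladder t ts a)
  prefix xs xs∈ xs< = subst Has (trans (map-++ (nth cs) xs (E n))
      (cong (map (nth cs) xs ++_) map-E))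
    (family xs∈ (All.++⁺ xs< (E-< n)))

  private
    a< : 0 < 5 + n
    a< = s≤s z≤n
    b< : 1 < 5 + n
    b< = s≤s (s≤s z≤n)
    d< : 2 < 5 + n
    d< = s≤s (s≤s (s≤s z≤n))
    e< : 3 < 5 + n
    e< = s≤s (s≤s (s≤s (s≤s z≤n)))
    t< : 4 < 5 + n
    t< = s≤s (s≤s (s≤s (s≤s (s≤s z≤n))))

  I₁′ : Has (d ∷ a ∷ b ∷ t ∷ d ∷ ladder t ts a)
  I₁′ = prefix (cd ∷ ca ∷ cb ∷ tt 0 ∷ cd ∷ []) (here refl) (d< ∷ a< ∷ b< ∷ t< ∷ d< ∷ [])

  I₂′ : Has (a ∷ d ∷ b ∷ t ∷ d ∷ b ∷ ladder t ts a)
  I₂′ = prefix (ca ∷ cd ∷ cb ∷ tt 0 ∷ cd ∷ cb ∷ []) (there (here refl))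
    (a< ∷ d< ∷ b< ∷ t< ∷ d< ∷ b< ∷ [])

  I₃′ : Has (a ∷ b ∷ d ∷ t ∷ d ∷ b ∷ ladder t ts a)
  I₃′ = prefix (ca ∷ cb ∷ cd ∷ tt 0 ∷ cd ∷ cb ∷ []) (there (there (here refl)))
    (a< ∷ b< ∷ d< ∷ t< ∷ d< ∷ b< ∷ [])

  I₄′ : Has (a ∷ b ∷ t ∷ d ∷ t ∷ b ∷ ladder t ts a)
  I₄′ = prefix (ca ∷ cb ∷ tt 0 ∷ cd ∷ tt 0 ∷ cb ∷ []) (there (there (there (here refl))))
    (a< ∷ b< ∷ t< ∷ d< ∷ t< ∷ b< ∷ [])

  I₅′ : Has (a ∷ b ∷ t ∷ d ∷ e ∷ d ∷ b ∷ ladder t ts a)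
  I₅′ = prefix (ca ∷ cb ∷ tt 0 ∷ cd ∷ ce ∷ cd ∷ cb ∷ []) (there (there (there (there (here refl)))))
    (a< ∷ b< ∷ t< ∷ d< ∷ e< ∷ d< ∷ b< ∷ [])

unique-++ : ∀ {xs ts : List Color} → Unique xs → Unique ts → (∀ {x} → x ∈ ts → x ∉ xs) → Unique
    (xs ++ ts)
unique-++ ux ut dis = Unique.++⁺ ux ut λ (x∈xs , x∈ts) → dis x∈ts x∈xs

module _ {a b d t : Color} {ts : List Color}
  (u : Unique (a ∷ b ∷ d ∷ t ∷ [])) (ut : Unique ts)
  (dis : ∀ {x} → x ∈ ts → x ∉ a ∷ b ∷ d ∷ t ∷ []) where

  private
    -- Slot 3 of the numbering belongs to `ce`, which does not occur in the first four families; a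
    -- fresh colour fills it.
    e : Color
    e = proj₁ (fresh (a ∷ b ∷ d ∷ t ∷ ts))
    e∉ : e ∉ a ∷ b ∷ d ∷ t ∷ ts
    e∉ = proj₂ (fresh (a ∷ b ∷ d ∷ t ∷ ts))
    u₅ : Unique (a ∷ b ∷ d ∷ e ∷ t ∷ ts)
    u₅ with unique-++ u ut dis
    ... | (ab ∷ ad ∷ at) ∷ (bd ∷ bt) ∷ dt ∷ v =
      (ab ∷ ad ∷ (λ q → e∉ (here (sym q))) ∷ at) ∷
      (bd ∷ (λ q → e∉ (there (here (sym q)))) ∷ bt) ∷
      ((λ q → e∉ (there (there (here (sym q))))) ∷ dt) ∷
      All.tabulate (λ i q → e∉ (there (there (there (subst (_∈ t ∷ ts) (sym q) i))))) ∷ v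

  I₁ : Has (d ∷ a ∷ b ∷ t ∷ d ∷ ladder t ts a)
  I₁ = I₁′ a b d e t ts u₅
  I₂ : Has (a ∷ d ∷ b ∷ t ∷ d ∷ b ∷ ladder t ts a)
  I₂ = I₂′ a b d e t ts u₅
  I₃ : Has (a ∷ b ∷ d ∷ t ∷ d ∷ b ∷ ladder t ts a)
  I₃ = I₃′ a b d e t ts u₅
  I₄ : Has (a ∷ b ∷ t ∷ d ∷ t ∷ b ∷ ladder t ts a)
  I₄ = I₄′ a b d e t ts u₅

I₅ : ∀ {a b d e t ts} → Unique (a ∷ b ∷ d ∷ e ∷ t ∷ []) → Unique ts →
  (∀ {x} → x ∈ ts → x ∉ a ∷ b ∷ d ∷ e ∷ t ∷ []) →
  Has (a ∷ b ∷ t ∷ d ∷ e ∷ d ∷ b ∷ ladder t ts a)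
I₅ {a} {b} {d} {e} {t} {ts} u ut dis = I₅′ a b d e t ts (unique-++ u ut dis)

-- Cuts and chains of overlapping colours

-- If L has been pushed on top of b, then the output of b can begin before V is read only
-- if there is a cut between L and V.
NoCut : Color → SockOrdering → SockOrdering → Set
NoCut b L V = ∃ λ c → c ≢ b × c ∈ L × c ∈ V

Cut : Color → SockOrdering → SockOrdering → Set
Cut b L V = ∀ {c} → c ≢ b → c ∈ L → c ∉ V

cut? : ∀ b L V → Cut b L V ⊎ NoCut b L V
cut? b L V with Any.any? (λ c → ¬? (c ≟ b) ×-dec (c ∈? V)) L
... | yes p = let (c , c∈ , c≢b , c∈V) = find p in inj₂ (c , c≢b , c∈ , c∈V)
... | no ¬p = inj₁ λ c≢b c∈L c∈V → ¬p (lose c∈L (c≢b , c∈V))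

-- No colour of L other than b survives t in V; colours occurring in R all count as
-- equally late.
Latest : Color → SockOrdering → SockOrdering → SockOrdering → Color → Set
Latest b L V R t = t ∈ R ⊎
  ∃₂ λ V₁ V₂ → V ≡ V₁ ++ t ∷ V₂ × Cut b L (V₂ ++ R)

-- If no pending colour reaches `R`, follow `V` up to the first position after which no colour of
-- `L` other than `b` is pending; the sock read just before it is `t`.
latest : ∀ b L V R → NoCut b L (V ++ R) → ∃ λ t → t ≢ b × t ∈ L × Latest b L V R t
latest b L V R nc with cut? b L R
... | inj₂ (t , t≢b , t∈L , t∈R) = t , t≢b , t∈L , inj₁ t∈R
... | inj₁ cutR = go V nc
  where
  go : ∀ V → NoCut b L (V ++ R) → ∃ λ t → t ≢ b × t ∈ L × Latest b L V R t
  go [] (c , c≢b , c∈L , c∈R) = ⊥-elim (cutR c≢b c∈L c∈R)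
  go (v ∷ V) (c , c≢b , c∈L , c∈) with cut? b L (V ++ R)
  ... | inj₂ nc′ with go V nc′
  ...   | t , t≢b , t∈L , inj₁ t∈R = t , t≢b , t∈L , inj₁ t∈R
  ...   | t , t≢b , t∈L , inj₂ (V₁ , V₂ , refl , cut) = t , t≢b , t∈L , inj₂
      (v ∷ V₁ , V₂ , refl , cut)
  go (v ∷ V) (c , c≢b , c∈L , here refl) | inj₁ cut = c , c≢b , c∈L , inj₂ ([] , V , refl , cut)
  go (v ∷ V) (c , c≢b , c∈L , there c∈) | inj₁ cut = ⊥-elim (cut c≢b c∈L c∈)

-- Besides the embedding, the fields record what keeps the rungs distinct from one another and from
-- the colours of the word put in front of the ladder.
record Chain (a b : Color) (L V : SockOrdering) (t : Color) (X : SockOrdering) : Set where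
  field
    rungs : List Color
    unique : Unique rungs
    unseen : ∀ {x} → x ∈ rungs → x ∉ L
    avoids : ∀ {x} → x ∈ rungs → x ≢ b
    inside : ∀ {x} → x ∈ rungs → x ∈ V
    embeds-in : ladder t rungs a ⊆ X

-- Greedy choice of the rungs: the latest colour seen before the last t overlaps t,
-- and it has not been seen before since t itself was latest.
chain : ∀ n a b L V R {t} → length V ≤ n → t ≢ b → t ∈ L →
  (∀ V₁ V₂ → V ≡ V₁ ++ V₂ → NoCut b (L ++ V₁) (V₂ ++ R)) →
  Latest b L V R t → Chain a b L V t (V ++ a ∷ R)
chain n a b L V R _ _ _ _ (inj₁ t∈R) = record
  { rungs = [] ; unique = [] ; unseen = λ () ; avoids = λ () ; inside = λ ()
  ; embeds-in = ++⁺ˡ V (refl ∷ from∈ t∈R) }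
chain zero a b L V R le _ _ _ (inj₂ ([] , V₂ , refl , _)) with le
... | ()
chain zero a b L V R le _ _ _ (inj₂ (_ ∷ _ , V₂ , refl , _)) with le
... | ()
chain (suc n) a b L V R {t} le t≢b t∈L noCut (inj₂ (V₁ , V₂ , refl , cut))
  with latest b (L ++ (V₁ ++ [ t ])) V₂ R (noCut (V₁ ++ [ t ]) V₂ (sym (++-assoc V₁ [ t ] V₂)))
... | t′ , t′≢b , t′∈ , lat = extend (chain n a b (L ++ (V₁ ++ [ t ])) V₂ R len t′≢b t′∈ noCut′ lat)
  where
  t′∈V₂R : Latest b (L ++ (V₁ ++ [ t ])) V₂ R t′ → t′ ∈ V₂ ++ R
  t′∈V₂R (inj₁ t′∈R) = ∈-++⁺ʳ V₂ t′∈R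
  t′∈V₂R (inj₂ (W , W′ , refl , _)) = ∈-++⁺ˡ (∈-++⁺ʳ W (here refl))
  t′∉L : t′ ∉ L
  t′∉L i = cut t′≢b i (t′∈V₂R lat)
  t′∈V₁ : t′ ∈ V₁
  t′∈V₁ with ∈-++⁻ L t′∈
  ... | inj₁ i = ⊥-elim (t′∉L i)
  ... | inj₂ i with ∈-++⁻ V₁ i
  ...   | inj₁ j = j
  ...   | inj₂ (here refl) = ⊥-elim (t′∉L t∈L)
  len : length V₂ ≤ n
  len = s≤s⁻¹ (≤-trans (≤-trans (m≤n+m (suc (length V₂)) (length V₁))
          (≤-reflexive (sym (length-++ V₁)))) le)
  noCut′ : ∀ W₁ W₂ → V₂ ≡ W₁ ++ W₂ → NoCut b ((L ++ (V₁ ++ [ t ])) ++ W₁) (W₂ ++ R)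
  noCut′ W₁ W₂ refl with noCut ((V₁ ++ [ t ]) ++ W₁) W₂
    (trans (sym (++-assoc V₁ [ t ] (W₁ ++ W₂))) (sym (++-assoc (V₁ ++ [ t ]) W₁ W₂)))
  ... | c , c≢b , c∈ , c∈′ = c , c≢b , subst (c ∈_) (sym (++-assoc L (V₁ ++ [ t ]) W₁)) c∈ , c∈′
  extend : Chain a b (L ++ (V₁ ++ [ t ])) V₂ t′ (V₂ ++ a ∷ R) → Chain a b L (V₁ ++ t ∷ V₂) t
      ((V₁ ++ t ∷ V₂) ++ a ∷ R)
  extend ch = record
    { rungs = t′ ∷ rungs
    ; unique = All.tabulate (λ i q → unseen i (subst (_∈ _) q t′∈)) ∷ unique
    ; unseen = λ { (here refl) → t′∉L ; (there i) → unseen i ∘ ∈-++⁺ˡ }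
    ; avoids = λ { (here refl) → t′≢b ; (there i) → avoids i }
    ; inside = λ { (here refl) → ∈-++⁺ˡ t′∈V₁ ; (there i) → ∈-++⁺ʳ V₁ (there (inside i)) }
    ; embeds-in = subst (ladder t (t′ ∷ rungs) a ⊆_) (sym (++-assoc V₁ (t ∷ V₂) (a ∷ R)))
        (++⁺ (from∈ t′∈V₁) (refl ∷ embeds-in)) }
    where open Chain ch

-- Patterns in words a b Q b P a R

∈⇒≢ : ∀ {x y : Color} {L} → x ∈ L → y ∉ L → x ≢ y
∈⇒≢ x∈ y∉ refl = y∉ x∈

middle : ∀ {x : Color} V {W} → x ∈ V ++ x ∷ W
middle V = ∈-++⁺ʳ V (here refl)

pick : ∀ {x : Color} {V xs W} → x ∈ V → xs ⊆ W → x ∷ xs ⊆ V ++ W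
pick x∈ s = ++⁺ (from∈ x∈) s

Sandwich : Color → SockOrdering → Set
Sandwich b Q = ∃₂ λ x y → x ≢ y × x ≢ b × y ≢ b × x ∷ y ∷ x ∷ [] ⊆ Q

avoids-list : ∀ {x} {cs : List Color} → All (x ≢_) cs → x ∉ cs
avoids-list (x≢c ∷ _) (here e) = x≢c e
avoids-list (_ ∷ ns) (there i) = avoids-list ns i

-- This shape covers two situations: `b` has waited for its last cut and `Q` is read afterwards, or
-- `Q` begins with what is already stacked on `b`. In both, `P` is uncut and carries the ladder.
module _ {a b : Color} {Q P R : SockOrdering} (a≢b : a ≢ b) (a∉Q : a ∉ Q) (a∉P : a ∉ P)
  (crossing : ∀ {c c′} → c ≢ b → c′ ≢ b → c ∈ Q → c′ ∈ Q → c ∈ R → c′ ∈ R → c ≡ c′)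
  (noCut : ∀ V₁ V₂ → P ≡ V₁ ++ V₂ → NoCut b (Q ++ V₁) (V₂ ++ R)) where

  private
    X : SockOrdering
    X = a ∷ b ∷ Q ++ b ∷ P ++ a ∷ R

  -- If `s` does not reach `R`, both `t` and the next rung `z` occur in `P` before the last `s`.
  -- With `z` before `t`, the colours `t` and `s` already open an `I₂` whose ladder starts at `z`,
  -- and `b` is left out; with `z` after `t`, the ladder starts at `s` with first rung `z`, and `b`
  -- and `t` form the front part of `I₂`.
  overtaken : ∀ {t s} → s ≢ b → t ≢ b → s ∈ Q → t ∈ Q → s ≢ t → t ∷ s ∷ [] ⊆ Q →
    Latest b Q P R s → t ∈ P → Has X
  overtaken {t} {s} s≢b t≢b s∈Q t∈Q s≢t ts⊆Q (inj₁ s∈R) t∈P =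
    has-mono (refl ∷ refl ∷ ++⁺ ts⊆Q (refl ∷ pick t∈P (refl ∷ from∈ s∈R)))
      (I₂ {a} {t} {b} {s} {[]}
        ((∈⇒≢ t∈Q a∉Q ∘ sym ∷ a≢b ∷ ∈⇒≢ s∈Q a∉Q ∘ sym ∷ []) ∷ (t≢b ∷ s≢t ∘ sym ∷ []) ∷
            (s≢b ∘ sym ∷ []) ∷ [] ∷ [])
        [] (λ ()))
  overtaken {t} {s} s≢b t≢b s∈Q t∈Q s≢t ts⊆Q (inj₂ (W , W′ , refl , cut)) t∈P
    with ∈-++⁻ W t∈P
  ... | inj₂ (here t≡s) = ⊥-elim (s≢t (sym t≡s))
  ... | inj₂ (there t∈W′) = ⊥-elim (cut t≢b t∈Q (∈-++⁺ˡ t∈W′))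
  ... | inj₁ t∈W with ∈-∃++ t∈W
  ...   | V , V′ , refl with latest b (Q ++ W ++ [ s ]) W′ R
      (noCut (W ++ [ s ]) W′ (sym (++-assoc W [ s ] W′)))
  ...     | z , z≢b , z∈ , lat = rung (chain (length W′) a b (Q ++ W ++ [ s ]) W′ R ≤-refl z≢b z∈
      noCut′ lat)
    where
    noCut′ : ∀ W₁ W₂ → W′ ≡ W₁ ++ W₂ → NoCut b ((Q ++ W ++ [ s ]) ++ W₁) (W₂ ++ R)
    noCut′ W₁ W₂ refl with noCut ((W ++ [ s ]) ++ W₁) W₂
      (trans (sym (++-assoc W [ s ] (W₁ ++ W₂))) (sym (++-assoc (W ++ [ s ]) W₁ W₂)))
    ... | c , c≢b , c∈ , c∈′ = c , c≢b , subst (c ∈_) (sym (++-assoc Q (W ++ [ s ]) W₁)) c∈ , c∈′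
    z∈W′R : Latest b (Q ++ W ++ [ s ]) W′ R z → z ∈ W′ ++ R
    z∈W′R (inj₁ z∈R) = ∈-++⁺ʳ W′ z∈R
    z∈W′R (inj₂ (U , U′ , refl , _)) = ∈-++⁺ˡ (middle U)
    z∉Q : z ∉ Q
    z∉Q z∈Q = cut z≢b z∈Q (z∈W′R lat)
    z∈W : z ∈ W
    z∈W with ∈-++⁻ Q z∈
    ... | inj₁ i = ⊥-elim (z∉Q i)
    ... | inj₂ i with ∈-++⁻ W i
    ...   | inj₁ j = j
    ...   | inj₂ (here refl) = ⊥-elim (z∉Q s∈Q)
    rung : Chain a b (Q ++ W ++ [ s ]) W′ z (W′ ++ a ∷ R) → Has X
    rung ch with ∈-++⁻ V z∈W
    ... | inj₂ (here refl) = ⊥-elim (z∉Q t∈Q)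
    ... | inj₁ z∈V = has-mono
      (subst (λ M → _ ⊆ a ∷ b ∷ Q ++ b ∷ M) (sym shape)
        (refl ∷ b ∷ʳ ++⁺ ts⊆Q (b ∷ʳ pick z∈V (refl ∷ ++⁺ˡ V′ (refl ∷ embeds-in)))))
      (I₂ {a} {s} {t} {z} {rungs}
        ((∈⇒≢ s∈Q a∉Q ∘ sym ∷ ∈⇒≢ t∈Q a∉Q ∘ sym ∷ ∈⇒≢ z∈W (a∉P ∘ ∈-++⁺ˡ) ∘ sym ∷ []) ∷
         (s≢t ∷ ∈⇒≢ s∈Q z∉Q ∷ []) ∷ (∈⇒≢ t∈Q z∉Q ∷ []) ∷ [] ∷ [])
        unique
        (λ i → avoids-list (
          ∈⇒≢ (∈-++⁺ʳ W (there (inside i))) a∉P ∷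
          (λ { refl → unseen i (∈-++⁺ˡ s∈Q) }) ∷
          (λ { refl → unseen i (∈-++⁺ˡ t∈Q) }) ∷
          (λ { refl → unseen i z∈ }) ∷ [])))
      where
      open Chain ch
      shape : ((V ++ t ∷ V′) ++ s ∷ W′) ++ a ∷ R ≡ V ++ t ∷ V′ ++ s ∷ W′ ++ a ∷ R
      shape = trans (++-assoc (V ++ t ∷ V′) _ _) (++-assoc V _ _)
    ... | inj₂ (there z∈V′) = has-mono
      (subst (λ M → _ ⊆ a ∷ b ∷ Q ++ b ∷ M) (sym shape)
        (refl ∷ refl ∷ ++⁺ ts⊆Q (refl ∷ ++⁺ˡ V (refl ∷ pick z∈V′ (refl ∷ embeds-in)))))
      (I₂ {a} {t} {b} {s} {z ∷ rungs}
        ((∈⇒≢ t∈Q a∉Q ∘ sym ∷ a≢b ∷ ∈⇒≢ s∈Q a∉Q ∘ sym ∷ []) ∷ (t≢b ∷ s≢t ∘ sym ∷ []) ∷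
            (s≢b ∘ sym ∷ []) ∷ [] ∷ [])
        (All.tabulate (λ { i refl → unseen i z∈ }) ∷ unique)
        λ { (here refl) → avoids-list (∈⇒≢ z∈W (a∉P ∘ ∈-++⁺ˡ) ∷ (λ { refl → z∉Q t∈Q }) ∷ z≢b ∷
            (λ { refl → z∉Q s∈Q }) ∷ [])
          ; (there i) → avoids-list (
              ∈⇒≢ (∈-++⁺ʳ W (there (inside i))) a∉P ∷
              (λ { refl → unseen i (∈-++⁺ˡ t∈Q) }) ∷ avoids i ∷
              (λ { refl → unseen i (∈-++⁺ˡ s∈Q) }) ∷ []) })
      where
      open Chain ch
      shape : ((V ++ t ∷ V′) ++ s ∷ W′) ++ a ∷ R ≡ V ++ t ∷ V′ ++ s ∷ W′ ++ a ∷ R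
      shape = trans (++-assoc (V ++ t ∷ V′) _ _) (++-assoc V _ _)

  -- A ladder always starts at `s`; the front part depends on the witness. A colour `t` before the
  -- first `s` that recurs in `Q` gives t s t and `I₃`, one that recurs in `P` is `overtaken`, and
  -- one reaching `R` is excluded. If `s` comes first, the sandwich gives `I₄`, `I₃` or `I₅`
  -- according to whether `s` is its outer colour, its inner colour or neither.
  blocked : ∀ {s Q₁ Q₂} → s ≢ b → Latest b Q P R s → Q ≡ Q₁ ++ s ∷ Q₂ → s ∉ Q₁ →
    NoCut b Q₁ (s ∷ Q₂ ++ P ++ R) ⊎ (Q₁ ≡ [] × Sandwich b Q) → Has X
  blocked {s} {Q₁} {Q₂} s≢b lat refl s∉Q₁ = caught
    where
    s∈Q : s ∈ Q
    s∈Q = middle Q₁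
    open Chain (chain (length P) a b Q P R ≤-refl s≢b s∈Q noCut lat)
    a≢ : ∀ {x} → x ∈ Q → a ≢ x
    a≢ x∈ refl = a∉Q x∈
    disjoint : ∀ {x} cs → x ∈ rungs → (∀ {c} → c ∈ cs → c ∈ Q) → All (x ≢_) cs
    disjoint cs i cs⊆ = All.tabulate λ { c∈ refl → unseen i (cs⊆ c∈) }
    ≢a : ∀ {x} → x ∈ rungs → x ≢ a
    ≢a i = ∈⇒≢ (inside i) a∉P
    b-tb : ∀ {t} → t ≢ b → t ≢ s → t ∈ Q → t ∷ s ∷ t ∷ [] ⊆ Q → Has X
    b-tb {t} t≢b t≢s t∈Q sub = has-mono (refl ∷ refl ∷ ++⁺ sub (refl ∷ embeds-in))
      (I₃ {a} {b} {t} {s} {rungs}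
        ((a≢b ∷ a≢ t∈Q ∷ a≢ s∈Q ∷ []) ∷ (t≢b ∘ sym ∷ s≢b ∘ sym ∷ []) ∷ (t≢s ∷ []) ∷ [] ∷ [])
        unique
        (λ i → avoids-list (≢a i ∷ avoids i ∷ disjoint (t ∷ s ∷ []) i
          λ { (here refl) → t∈Q ; (there (here refl)) → s∈Q })))
    crossed : ∀ {t} → t ≢ b → t ∈ Q → t ∈ R → Latest b Q P R s → t ≡ s
    crossed t≢b t∈Q t∈R (inj₁ s∈R) = crossing t≢b s≢b t∈Q s∈Q t∈R s∈R
    crossed t≢b t∈Q t∈R (inj₂ (_ , V₂ , _ , cut)) = ⊥-elim (cut t≢b t∈Q (∈-++⁺ʳ V₂ t∈R))
    caught : NoCut b Q₁ (s ∷ Q₂ ++ P ++ R) ⊎ (Q₁ ≡ [] × Sandwich b Q) → Has X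
    caught (inj₁ (t , t≢b , t∈Q₁ , here refl)) = ⊥-elim (s∉Q₁ t∈Q₁)
    caught (inj₁ (t , t≢b , t∈Q₁ , there t∈)) with ∈-++⁻ Q₂ t∈
    ... | inj₁ t∈Q₂ = b-tb t≢b (∈⇒≢ t∈Q₁ s∉Q₁) (∈-++⁺ˡ t∈Q₁) (pick t∈Q₁ (refl ∷ from∈ t∈Q₂))
    ... | inj₂ t∈′ with ∈-++⁻ P t∈′
    ...   | inj₁ t∈P = overtaken s≢b t≢b s∈Q (∈-++⁺ˡ t∈Q₁) (∈⇒≢ t∈Q₁ s∉Q₁ ∘ sym)
              (pick t∈Q₁ (refl ∷ minimum Q₂)) lat t∈P
    ...   | inj₂ t∈R = ⊥-elim (∈⇒≢ t∈Q₁ s∉Q₁ (crossed t≢b (∈-++⁺ˡ t∈Q₁) t∈R lat))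
    caught (inj₂ (refl , x , y , x≢y , x≢b , y≢b , (refl ∷ sub))) =
      has-mono (refl ∷ refl ∷ refl ∷ ++⁺ sub (refl ∷ embeds-in))
        (I₄ {a} {b} {y} {s} {rungs}
          ((a≢b ∷ a≢ y∈Q ∷ a≢ s∈Q ∷ []) ∷ (y≢b ∘ sym ∷ s≢b ∘ sym ∷ []) ∷ (x≢y ∘ sym ∷ []) ∷ [] ∷ [])
          unique
          (λ i → avoids-list (≢a i ∷ avoids i ∷ disjoint (y ∷ s ∷ []) i
            λ { (here refl) → y∈Q ; (there (here refl)) → s∈Q })))
      where
      y∈Q : y ∈ Q
      y∈Q = there (lookup sub (here refl))
    caught (inj₂ (refl , x , y , x≢y , x≢b , y≢b , (_ ∷ʳ sub))) with x ≟ s | y ≟ s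
    ... | yes refl | _ = caught (inj₂ (refl , x , y , x≢y , x≢b , y≢b , refl ∷ ∷ˡ⁻ sub))
    ... | no x≢s | yes refl = b-tb x≢b x≢s (there (lookup sub (here refl))) (s ∷ʳ sub)
    ... | no x≢s | no y≢s =
      has-mono (refl ∷ refl ∷ refl ∷ ++⁺ sub (refl ∷ embeds-in))
        (I₅ {a} {b} {x} {y} {s} {rungs}
          ((a≢b ∷ a≢ x∈Q ∷ a≢ y∈Q ∷ a≢ s∈Q ∷ []) ∷ (x≢b ∘ sym ∷ y≢b ∘ sym ∷ s≢b ∘ sym ∷ []) ∷
           (x≢y ∷ x≢s ∷ []) ∷ (y≢s ∷ []) ∷ [] ∷ [])
          unique
          (λ i → avoids-list (≢a i ∷ avoids i ∷ disjoint (x ∷ y ∷ s ∷ []) i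
            λ { (here refl) → x∈Q ; (there (here refl)) → y∈Q ; (there (there (here refl))) → s∈Q
                })))
      where
      x∈Q : x ∈ Q
      x∈Q = there (lookup sub (here refl))
      y∈Q : y ∈ Q
      y∈Q = there (lookup sub (there (here refl)))

-- Runs on contracted stacks and their soundness

-- Run o S R F: from the stack S (top first, runs of equal socks contracted) and input R,
-- with o the colour that is currently being output, the input can be exhausted so that
-- F is left on the stack.
data Run : Maybe Color → (S R F : SockOrdering) → Set where
  stop : ∀ {F} → Run nothing F [] F
  push : ∀ {o r S R F} → r ∉ S → Run o (r ∷ S) R F → Run o S (r ∷ R) F
  dup : ∀ {o r S R F} → Run o (r ∷ S) R F → Run o (r ∷ S) (r ∷ R) F
  begin : ∀ {c S R F} → Run (just c) S R F → Run nothing (c ∷ S) R F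
  emit : ∀ {c S R F} → Run (just c) S R F → Run (just c) S (c ∷ R) F
  close : ∀ {c S R F} → c ∉ S → c ∉ R → Run nothing S R F → Run (just c) S R F

data Grouped : SockOrdering → Set where
  [] : Grouped []
  new : ∀ {c F} → c ∉ F → Grouped F → Grouped (c ∷ F)
  more : ∀ {c F} → Grouped (c ∷ F) → Grouped (c ∷ c ∷ F)

grouped-tail : ∀ {c F} → Grouped (c ∷ F) → Grouped F
grouped-tail (new _ g) = g
grouped-tail (more g) = g

grouped-consecutive : ∀ {F} → Grouped F → Consecutive F
grouped-consecutive g (x ∷ A) B C c refl = grouped-consecutive (grouped-tail g) A B C c refl
grouped-consecutive g [] [] C c refl = []
grouped-consecutive (new c∉ g) [] (y ∷ B) C c refl = ⊥-elim (c∉ (there (middle B)))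
grouped-consecutive (more g) [] (c ∷ B) C c refl = refl ∷ grouped-consecutive g [] B C c refl

data Stacked : SockOrdering → SockOrdering → Set where
  [] : Stacked [] []
  new : ∀ {c S T} → Stacked S T → Stacked (c ∷ S) (c ∷ T)
  more : ∀ {c S T} → Stacked (c ∷ S) T → Stacked (c ∷ S) (c ∷ T)

Output : Maybe Color → SockOrdering → Set
Output nothing F = Grouped F
Output (just c) F = Grouped (c ∷ F)

Present : Maybe Color → (S R : SockOrdering) → Color → Set
Present o S R c = c ∈ S ⊎ c ∈ R ⊎ o ≡ just c

present-push : ∀ {o r S R c} → Present o (r ∷ S) R c → Present o S (r ∷ R) c
present-push (inj₁ (here e)) = inj₂ (inj₁ (here e))
present-push (inj₁ (there i)) = inj₁ i
present-push (inj₂ (inj₁ i)) = inj₂ (inj₁ (there i))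
present-push (inj₂ (inj₂ e)) = inj₂ (inj₂ e)

present-∷ : ∀ {o r S R c} → Present o S R c → Present o S (r ∷ R) c
present-∷ (inj₁ i) = inj₁ i
present-∷ (inj₂ (inj₁ i)) = inj₂ (inj₁ (there i))
present-∷ (inj₂ (inj₂ e)) = inj₂ (inj₂ e)

present-begin : ∀ {r S R c} → Present (just r) S R c → Present nothing (r ∷ S) R c
present-begin (inj₁ i) = inj₁ (there i)
present-begin (inj₂ (inj₁ i)) = inj₂ (inj₁ i)
present-begin (inj₂ (inj₂ refl)) = inj₁ (here refl)

present-close : ∀ {o S R c} → Present nothing S R c → Present o S R c
present-close (inj₁ i) = inj₁ i
present-close (inj₂ (inj₁ i)) = inj₂ (inj₁ i)

-- The last component makes `close` sound: a colour absent from stack and input cannot reappear in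
-- the later output.
Emits : Maybe Color → (S R T : SockOrdering) → Set
Emits o S R T = ∃ λ F → (∀ O → Runs T R O (O ++ F)) × Output o F ×
  (∀ {c} → c ∈ F → Present o S R c)

runs-assoc : ∀ {S R} O {s F} → Runs S R (O ++ [ s ]) ((O ++ [ s ]) ++ F) →
  Runs S R (O ++ [ s ]) (O ++ s ∷ F)
runs-assoc O {s} {F} = subst (Runs _ _ (O ++ [ s ])) (++-assoc O [ s ] F)

run-sound : ∀ {o S R T} → Run o S R [] → Stacked S T → Emits o S R T
run-sound stop [] = [] , (λ O → subst (Runs [] [] O) (sym (++-identityʳ O)) done) , [] , λ ()
run-sound (push _ run) st with run-sound run (new st)
... | F , runs , out , cols = F , (λ O → push (runs O)) , out , present-push ∘ cols
run-sound (dup run) st with run-sound run (more st)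
... | F , runs , out , cols = F , (λ O → push (runs O)) , out , present-∷ ∘ cols
run-sound {S = c ∷ S} {R} (begin run) st = weaken (pop-all st)
  where
  -- One `begin` stands for popping the whole block of equal socks.
  pop-all : ∀ {T} → Stacked (c ∷ S) T → ∃ λ F → (∀ O → Runs T R O (O ++ c ∷ F)) ×
    Grouped (c ∷ F) × (∀ {x} → x ∈ c ∷ F → Present nothing (c ∷ S) R x)
  pop-all (new st) with run-sound run st
  ... | F , runs , out , cols = F , (λ O → pop (runs-assoc O (runs (O ++ [ c ])))) , out ,
          λ { (here e) → inj₁ (here e) ; (there i) → present-begin (cols i) }
  pop-all (more st) with pop-all st
  ... | F , runs , out , cols = c ∷ F , (λ O → pop (runs-assoc O (runs (O ++ [ c ])))) , more out ,
          λ { (here e) → inj₁ (here e) ; (there i) → cols i }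
  weaken : ∀ {T} → (∃ λ F → (∀ O → Runs T R O (O ++ c ∷ F)) × Grouped (c ∷ F) ×
    (∀ {x} → x ∈ c ∷ F → Present nothing (c ∷ S) R x)) → Emits nothing (c ∷ S) R T
  weaken (F , rest) = c ∷ F , rest
run-sound (emit {c} run) st with run-sound run st
... | F , runs , out , cols =
  c ∷ F , (λ O → push (pop (runs-assoc O (runs (O ++ [ c ]))))) , more out ,
  λ { (here refl) → inj₂ (inj₁ (here refl)) ; (there i) → present-∷ (cols i) }
run-sound {S = S} {R} (close {c} c∉S c∉R run) st with run-sound run st
... | F , runs , out , cols = F , runs , new (absent ∘ cols) out , present-close ∘ cols
  where
  absent : ¬ Present nothing S R c
  absent (inj₁ i) = c∉S i
  absent (inj₂ (inj₁ i)) = c∉R i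

run-sortable : ∀ {X} → Run nothing [] X [] → FootSortable X
run-sortable run with run-sound run []
... | F , runs , out , _ = F , runs [] , grouped-consecutive out

run-colours : ∀ {o S R F} → Run o S R F → ∀ {c} → c ∈ F → c ∈ S ⊎ c ∈ R
run-colours stop c∈ = inj₁ c∈
run-colours (push _ run) c∈ with run-colours run c∈
... | inj₁ (here e) = inj₂ (here e)
... | inj₁ (there i) = inj₁ i
... | inj₂ i = inj₂ (there i)
run-colours (dup run) c∈ with run-colours run c∈
... | inj₁ i = inj₁ i
... | inj₂ i = inj₂ (there i)
run-colours (begin run) c∈ with run-colours run c∈
... | inj₁ i = inj₁ (there i)
... | inj₂ i = inj₂ i
run-colours (emit run) c∈ with run-colours run c∈
... | inj₁ i = inj₁ i
... | inj₂ i = inj₂ (there i)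
run-colours (close _ _ run) c∈ = run-colours run c∈

-- The premises preserve the side conditions of `push` and `close`: no colour of the first run lies
-- in `D`, and a closed colour cannot return in `Q`, since it would then belong to `F` and so still
-- be on the stack or in the input.
run-++ : ∀ {o S R F D Q G} → Run o S R F → Run nothing (F ++ D) Q G →
  (∀ {c} → Present o S R c → c ∉ D) → (∀ {c} → Present o S R c → c ∈ Q → c ∈ F) →
  Run o (S ++ D) (R ++ Q) G
run-++ stop rest d q = rest
run-++ {S = S} (push r∉ run) rest d q =
  push (λ i → either (∈-++⁻ S i) r∉ (d (inj₂ (inj₁ (here refl)))))
    (run-++ run rest (d ∘ present-push) (q ∘ present-push))
run-++ (dup run) rest d q = dup (run-++ run rest (d ∘ present-∷) (q ∘ present-∷))
run-++ (begin run) rest d q = begin (run-++ run rest (d ∘ present-begin) (q ∘ present-begin))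
run-++ (emit run) rest d q = emit (run-++ run rest (d ∘ present-∷) (q ∘ present-∷))
run-++ {S = S} {R} (close c∉S c∉R run) rest d q = close
  (λ i → either (∈-++⁻ S i) c∉S (d (inj₂ (inj₂ refl))))
  (λ i → either (∈-++⁻ R i) c∉R
    λ j → either (run-colours run (q (inj₂ (inj₂ refl)) j)) c∉S c∉R)
  (run-++ run rest (d ∘ present-close) (q ∘ present-close))

-- Postponing the output of the bottom colour

not-stacked : ∀ {u S R F} → Run (just u) S R F → u ∉ S
not-stacked (push _ run) u∈ = not-stacked run (there u∈)
not-stacked (dup run) u∈ = not-stacked run u∈
not-stacked (emit run) u∈ = not-stacked run u∈
not-stacked (close u∉ _ _) u∈ = u∉ u∈

-- The final `u` keeps the output of `u` open, so nothing is popped and `x` stays below the top; a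
-- further sock `x` could then be neither pushed nor duplicated.
buried : ∀ {u x y S W F} P → Run (just u) (y ∷ S) W F → W ≡ P ++ [ u ] →
  x ∈ S → x ≢ y → x ∉ P
buried (p ∷ P) (push p∉ run) refl x∈S x≢y (here refl) = p∉ (there x∈S)
buried (p ∷ P) (push p∉ run) refl x∈S x≢y (there i) =
  buried P run refl (there x∈S) (λ { refl → p∉ (there x∈S) }) i
buried (p ∷ P) (dup run) refl x∈S x≢y (here e) = x≢y e
buried (p ∷ P) (dup run) refl x∈S x≢y (there i) = buried P run refl x∈S x≢y i
buried (p ∷ P) (emit run) refl x∈S x≢y (here refl) = not-stacked run (there x∈S)
buried (p ∷ P) (emit run) refl x∈S x≢y (there i) = buried P run refl x∈S x≢y i
buried (p ∷ P) (close _ u∉ run) refl x∈S x≢y i = u∉ (middle (p ∷ P))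

top : SockOrdering → Maybe Color
top [] = nothing
top (x ∷ _) = just x

-- While u is being output up to its last sock, everything else gets stacked without being
-- popped; so one can as well keep u on the stack and output each other colour at once.
postpone-open : ∀ {u S W} P → Run (just u) S W [] → W ≡ P ++ [ u ] → Run (top S) [ u ] P [ u ]
postpone-open [] (push _ run) refl = ⊥-elim (not-stacked run (here refl))
postpone-open [] (dup run) refl = ⊥-elim (not-stacked run (here refl))
postpone-open {S = []} [] (emit run) refl = stop
postpone-open {S = x ∷ S} [] (emit run) refl =
  close (λ { (here refl) → not-stacked run (here refl) }) (λ ()) stop
postpone-open [] (close _ u∉ _) refl = ⊥-elim (u∉ (here refl))
postpone-open {u} {[]} (p ∷ P) (push _ run) refl =
  push (λ { (here refl) → not-stacked run (here refl) }) (begin (postpone-open P run refl))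
postpone-open {u} {x ∷ S} (p ∷ P) (push p∉ run) refl =
  close (λ { (here refl) → not-stacked run (there (here refl)) })
    (λ { (here refl) → p∉ (here refl)
       ; (there i) → buried P run refl (here refl) (λ { refl → p∉ (here refl) }) i })
    (push (λ { (here refl) → not-stacked run (here refl) }) (begin (postpone-open P run refl)))
postpone-open (p ∷ P) (dup run) refl = emit (postpone-open P run refl)
postpone-open (p ∷ P) (emit run) refl = dup (postpone-open P run refl)
postpone-open (p ∷ P) (close _ u∉ _) refl = ⊥-elim (u∉ (middle (p ∷ P)))

-- The run is copied until `u` starts being output; from there `postpone-open` takes over.
postpone′ : ∀ {u o T W} S P → Run o T W [] → T ≡ S ++ [ u ] → W ≡ P ++ [ u ] → u ∉ S →
  o ≢ just u → Run o T P [ u ]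
postpone′ S [] (push r∉ run) refl refl u∉ o≢ = ⊥-elim (r∉ (∈-++⁺ʳ S (here refl)))
postpone′ {u} S (p ∷ P) (push r∉ run) refl refl u∉ o≢ =
  push r∉ (postpone′ (p ∷ S) P run refl refl
    (λ { (here refl) → r∉ (∈-++⁺ʳ S (here refl)) ; (there i) → u∉ i }) o≢)
postpone′ [] [] (dup (begin run)) refl refl u∉ o≢ = stop
postpone′ [] [] (dup (close c∉ _ run)) refl refl u∉ o≢ = close c∉ (λ ()) stop
postpone′ (s ∷ S) [] (dup run) refl refl u∉ o≢ = ⊥-elim (u∉ (here refl))
postpone′ S (p ∷ P) (dup run) e refl u∉ o≢ = dup (postpone′ S P run e refl u∉ o≢)
postpone′ [] P (begin run) refl refl u∉ o≢ = postpone-open P run refl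
postpone′ (s ∷ S) P (begin run) refl refl u∉ o≢ =
  begin (postpone′ S P run refl refl (u∉ ∘ there) λ { refl → u∉ (here refl) })
postpone′ S [] (emit run) refl refl u∉ o≢ = ⊥-elim (o≢ refl)
postpone′ S (p ∷ P) (emit run) e refl u∉ o≢ = emit (postpone′ S P run e refl u∉ o≢)
postpone′ S P (close c∉ c∉W run) e refl u∉ o≢ =
  close c∉ (c∉W ∘ ∈-++⁺ˡ) (postpone′ S P run e refl u∉ λ ())

postpone : ∀ {u} S P → Run nothing (S ++ [ u ]) (P ++ [ u ]) [] → u ∉ S →
  Run nothing (S ++ [ u ]) P [ u ]
postpone S P run u∉ = postpone′ S P run refl refl u∉ λ ()

-- Stacking everything while one colour is output

record Pushed (u : Color) (S A : SockOrdering) : Set where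
  field
    layers : SockOrdering
    unique : Unique (layers ++ S)
    layers⊆ : reverse layers ⊆ A
    fresh-u : u ∉ layers
    covers : ∀ {c} → c ∈ A → c ≢ u → c ∈ layers ++ S
    resume : ∀ {B F} → Run (just u) (layers ++ S) B F → Run (just u) S (A ++ B) F

-- A sock `x` other than `u` is new, equals the top, or lies below the top `y`. Only the last case
-- fails, and then x y x can be read off the stack, bottom first, followed by the input.
pushing : ∀ u S A → Unique S → u ∉ S → Pushed u S A ⊎ Sandwich u (reverse S ++ A)
pushing u S [] uS u∉ = inj₁ record
  { layers = [] ; unique = uS ; layers⊆ = [] ; fresh-u = λ () ; covers = λ () ; resume = id }
pushing u S (x ∷ A) uS u∉ with x ≟ u
pushing u S (x ∷ A) uS u∉ | yes refl with pushing u S A uS u∉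
... | inj₂ (p , q , p≢q , p≢ , q≢ , sub) =
  inj₂ (p , q , p≢q , p≢ , q≢ , ⊆-trans sub (++⁺ (⊆-refl {x = reverse S}) (u ∷ʳ ⊆-refl)))
... | inj₁ p = inj₁ record
  { layers = layers ; unique = unique ; layers⊆ = u ∷ʳ layers⊆ ; fresh-u = fresh-u
  ; covers = λ { (here e) c≢ → ⊥-elim (c≢ e) ; (there i) c≢ → covers i c≢ }
  ; resume = λ run → emit (resume run) }
  where open Pushed p
pushing u S (x ∷ A) uS u∉ | no x≢u with x ∈? S
pushing u S (x ∷ A) uS u∉ | no x≢u | no x∉S
  with pushing u (x ∷ S) A (All.tabulate (λ { i refl → x∉S i }) ∷ uS)
         (λ { (here e) → x≢u (sym e) ; (there i) → u∉ i })
... | inj₂ (p , q , p≢q , p≢ , q≢ , sub) = inj₂ (p , q , p≢q , p≢ , q≢ ,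
  subst (_ ⊆_) (trans (cong (_++ A) (unfold-reverse x S)) (++-assoc (reverse S) [ x ] A)) sub)
... | inj₁ p = inj₁ record
  { layers = layers ++ [ x ]
  ; unique = subst Unique eq unique
  ; layers⊆ = subst (_⊆ x ∷ A) (sym (reverse-++ layers [ x ])) (refl ∷ layers⊆)
  ; fresh-u = λ i → [ fresh-u , (λ { (here e) → x≢u (sym e) }) ]′ (∈-++⁻ layers i)
  ; covers = λ { (here refl) _ → ∈-++⁺ˡ (∈-++⁺ʳ layers (here refl))
               ; {c} (there i) c≢ → subst (c ∈_) eq (covers i c≢) }
  ; resume = λ {B} {F} run → push x∉S (resume (subst (λ T → Run (just u) T B F) (sym eq) run)) }
  where
  open Pushed p
  eq : layers ++ x ∷ S ≡ (layers ++ [ x ]) ++ S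
  eq = sym (++-assoc layers [ x ] S)
pushing u (y ∷ S) (x ∷ A) uS u∉ | no x≢u | yes (here refl) with pushing u (y ∷ S) A uS u∉
... | inj₂ (p , q , p≢q , p≢ , q≢ , sub) =
  inj₂ (p , q , p≢q , p≢ , q≢ , ⊆-trans sub (++⁺ (⊆-refl {x = reverse (y ∷ S)}) (y ∷ʳ ⊆-refl)))
... | inj₁ p = inj₁ record
  { layers = layers ; unique = unique ; layers⊆ = y ∷ʳ layers⊆ ; fresh-u = fresh-u
  ; covers = λ { (here refl) _ → ∈-++⁺ʳ layers (here refl) ; (there i) c≢ → covers i c≢ }
  ; resume = λ run → dup (resume run) }
  where open Pushed p
pushing u (y ∷ S) (x ∷ A) (y∉ ∷ uS) u∉ | no x≢u | yes (there x∈S) =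
  inj₂ (x , y , (λ e → All.lookup y∉ x∈S (sym e)) , x≢u , (λ e → u∉ (here (sym e))) ,
    subst (_ ⊆_) (sym (trans (cong (_++ x ∷ A) (unfold-reverse y S))
        (++-assoc (reverse S) [ y ] (x ∷ A))))
      (++⁺ (from∈ (reverse⁺ x∈S)) (refl ∷ refl ∷ minimum A)))

first : ∀ {x : Color} V → x ∈ V → ∃₂ λ V₁ V₂ → V ≡ V₁ ++ x ∷ V₂ × x ∉ V₁
first {x} (v ∷ V) x∈ with x ≟ v
... | yes refl = [] , V , refl , λ ()
first (v ∷ V) (here e) | no x≢v = ⊥-elim (x≢v e)
first (v ∷ V) (there i) | no x≢v with first V i
... | V₁ , V₂ , refl , x∉ = v ∷ V₁ , V₂ , refl , λ { (here e) → x≢v e ; (there j) → x∉ j }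

last : ∀ {x : Color} V → x ∈ V → ∃₂ λ V₁ V₂ → V ≡ V₁ ++ x ∷ V₂ × x ∉ V₂
last {x} (v ∷ V) x∈ with x ∈? V
... | yes i with last V i
...   | V₁ , V₂ , refl , x∉ = v ∷ V₁ , V₂ , refl , x∉
last (v ∷ V) (here refl) | no x∉ = [] , V , refl , x∉
last (v ∷ V) (there i) | no x∉ = ⊥-elim (x∉ i)

skip-constant : ∀ b (V : SockOrdering) → All (_≡ b) V ⊎
  ∃₂ λ V₁ h → ∃ λ V₂ → V ≡ V₁ ++ h ∷ V₂ × All (_≡ b) V₁ × h ≢ b
skip-constant b [] = inj₁ []
skip-constant b (v ∷ V) with v ≟ b
... | no v≢b = inj₂ ([] , v , V , refl , [] , v≢b)
... | yes v≡b with skip-constant b V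
...   | inj₁ all = inj₁ (v≡b ∷ all)
...   | inj₂ (V₁ , h , V₂ , refl , all , h≢b) = inj₂ (v ∷ V₁ , h , V₂ , refl , v≡b ∷ all , h≢b)

-- Last cuts

NoCuts : Color → (L P R : SockOrdering) → Set
NoCuts b L P R = ∀ V₁ V₂ → P ≡ V₁ ++ V₂ → NoCut b (L ++ V₁) (V₂ ++ R)

noCut-map : ∀ {b L L′ V V′} → (∀ {c} → c ≢ b → c ∈ L → c ∈ L′) →
  (∀ {c} → c ≢ b → c ∈ V → c ∈ V′) → NoCut b L V → NoCut b L′ V′
noCut-map f g (c , c≢b , c∈L , c∈V) = c , c≢b , f c≢b c∈L , g c≢b c∈V

-- Nothing but `b` survives the cut, so every later position is straddled by a colour read after it.
-- This is why `noCutAfter` leaves out `L` and `before` and requires a nonempty prefix.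
record LastCut (b : Color) (L P R : SockOrdering) : Set where
  field
    before after : SockOrdering
    split : P ≡ before ++ after
    cut : Cut b (L ++ before) (after ++ R)
    noCutAfter : ∀ v V₁ V₂ → after ≡ (v ∷ V₁) ++ V₂ → NoCut b (v ∷ V₁) (V₂ ++ R)

lastCut : ∀ b L P R → LastCut b L P R ⊎ NoCuts b L P R
lastCut b L [] R with cut? b L R
... | inj₁ cut = inj₁ record
  { before = [] ; after = [] ; split = refl
  ; cut = subst (λ M → Cut b M R) (sym (++-identityʳ L)) cut ; noCutAfter = λ _ _ _ () }
... | inj₂ nc = inj₂ λ { [] [] refl → subst (λ M → NoCut b M R) (sym (++-identityʳ L)) nc }
lastCut b L (v ∷ P) R with lastCut b (L ++ [ v ]) P R
... | inj₁ lc = inj₁ record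
  { before = v ∷ before ; after = after ; split = cong (v ∷_) split
  ; cut = subst (λ M → Cut b M (after ++ R)) (++-assoc L [ v ] before) cut ; noCutAfter = noCutAfter
      }
  where open LastCut lc
... | inj₂ ncs with cut? b L (v ∷ P ++ R)
...   | inj₂ nc = inj₂ λ
  { [] _ refl → subst (λ M → NoCut b M (v ∷ P ++ R)) (sym (++-identityʳ L)) nc
  ; (_ ∷ V₁) V₂ refl → subst (λ M → NoCut b M (V₂ ++ R)) (++-assoc L [ v ] V₁) (ncs V₁ V₂ refl) }
...   | inj₁ cut = inj₁ record
  { before = [] ; after = v ∷ P ; split = refl
  ; cut = subst (λ M → Cut b M (v ∷ P ++ R)) (sym (++-identityʳ L)) cut
  ; noCutAfter = after }
  where
  after : ∀ w V₁ V₂ → v ∷ P ≡ (w ∷ V₁) ++ V₂ → NoCut b (w ∷ V₁) (V₂ ++ R)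
  after w V₁ V₂ refl with ncs V₁ V₂ refl
  ... | c , c≢b , c∈ , c∈′ with ∈-++⁻ L (subst (c ∈_) (++-assoc L [ v ] V₁) c∈)
  ...   | inj₁ c∈L = ⊥-elim (cut c≢b c∈L (there
      (subst (c ∈_) (sym (++-assoc V₁ V₂ R)) (∈-++⁺ʳ V₁ c∈′))))
  ...   | inj₂ c∈V = c , c≢b , c∈V , c∈′

-- Induction statements and the forced phase before the next a

-- `C` is written bottom to top, that is, in the order of pushing, so that it can be compared with
-- subwords of the input.
Sortable : (C R : SockOrdering) → Set
Sortable C R = Run nothing (reverse C) R []

-- The word m C m R records why C lies on the stack in this order: it has been pushed
-- while m was being output.
Claim : ℕ → Set
Claim n = ∀ m C R → length C + length R ≤ n → Unique C → m ∉ C → m ∉ R →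
  Sortable C R ⊎ Has (m ∷ C ++ m ∷ R)

Theorem : ℕ → Set
Theorem n = ∀ X → length X ≤ n → Sortable [] X ⊎ Has X

emits : ∀ {c S R F} V → All (_≡ c) V → Run (just c) S R F → Run (just c) S (V ++ R) F
emits [] [] run = run
emits (v ∷ V) (refl ∷ all) run = emit (emits V all run)

after-push : ∀ {c R F} → Run nothing [] (c ∷ R) F → Run nothing [ c ] R F
after-push (push _ run) = run

unique-reverse : ∀ {L : List Color} → Unique L → Unique (reverse L)
unique-reverse {[]} u = []
unique-reverse {x ∷ L} (x∉ ∷ u) = subst Unique (sym (unfold-reverse x L))
  (Unique.++⁺ (unique-reverse u) ([] ∷ []) λ { (i , here refl) → All.lookup x∉ (reverse⁻ i) refl })

-- `C` lies on `a`, `P` is the input before the next `a`, and `u` is the one colour that crosses it.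
-- A phase consumes `P` and leaves just `u` above `a`; patterns are looked for in the ambient word
-- `X`.
module Phase {a u : Color} {R X : SockOrdering} (n : ℕ) (claim : Claim n) (theorem : Theorem n)
  (u∈R : u ∈ R) (a≢u : a ≢ u) where

  -- Why C lies on top of a: either C has at most one colour, or it was pushed while some d
  -- was being output, where d comes from below a (outer) or from above a (inner).
  data Context (C P : SockOrdering) : Set where
    single : ∀ {b} → C ≡ [ b ] → Context C P
    outer : ∀ d → d ∉ C → d ∉ P → d ≢ a → d ∷ a ∷ C ++ d ∷ P ++ a ∷ R ⊆ X → Context C P
    inner : ∀ d → d ∉ C → d ∉ P → d ≢ a → a ∷ d ∷ C ++ d ∷ P ++ a ∷ R ⊆ X →
      (∀ {b B} → C ≡ b ∷ B → b ∈ P ++ R) → Context C P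

  -- A sock `b` is appended to `P₁`, the result is sorted by induction, and `postpone` turns this
  -- into a run that keeps `b`. The appended sock exists in `X` by `P₁⊆`, so a pattern found instead
  -- transfers.
  hold-bottom : ∀ {b B P} P₁ → Unique (b ∷ B) → suc (length B) + suc (length P₁) ≤ n →
    Context (b ∷ B) P → b ∷ B ++ P ++ a ∷ R ⊆ X → P₁ ++ [ b ] ⊆ P ++ a ∷ R →
        (∀ {c} → c ∈ P₁ → c ∈ P) →
    Run nothing (reverse (b ∷ B)) P₁ [ b ] ⊎ Has X
  hold-bottom {b} {B} {P} P₁ (b∉ ∷ uB) len ctx sub P₁⊆ in-P = go ctx
    where
    b∉B : b ∉ reverse B
    b∉B i = All.lookup b∉ (reverse⁻ {xs = B} i) refl
    held : Sortable (b ∷ B) (P₁ ++ [ b ]) → Run nothing (reverse (b ∷ B)) P₁ [ b ]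
    held run = subst (λ S → Run nothing S P₁ [ b ]) (sym (unfold-reverse b B))
      (postpone (reverse B) P₁ (subst (λ S → Run nothing S (P₁ ++ [ b ]) []) (unfold-reverse b B)
          run) b∉B)
    len′ : suc (length B) + length (P₁ ++ [ b ]) ≤ n
    len′ = ≤-trans (≤-reflexive (cong (suc (length B) +_)
        (trans (length-++ P₁) (+-comm (length P₁) 1)))) len
    framed : ∀ d → d ∉ b ∷ B → d ∉ P → d ∷ (b ∷ B) ++ d ∷ P ++ a ∷ R ⊆ X →
      Run nothing (reverse (b ∷ B)) P₁ [ b ] ⊎ Has X
    framed d d∉ d∉P d⊆ with claim d (b ∷ B) (P₁ ++ [ b ]) len′ (b∉ ∷ uB) d∉
      (λ i → [ d∉P ∘ in-P , (λ { (here refl) → d∉ (here refl) }) ]′ (∈-++⁻ P₁ i))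
    ... | inj₁ run = inj₁ (held run)
    ... | inj₂ has = inj₂ (has-mono (⊆-trans (refl ∷ refl ∷ ++⁺ (⊆-refl {x = B}) (refl ∷ P₁⊆)) d⊆)
        has)
    go : Context (b ∷ B) P → Run nothing (reverse (b ∷ B)) P₁ [ b ] ⊎ Has X
    go (single refl) with theorem (b ∷ P₁ ++ [ b ]) len′
    ... | inj₁ run = inj₁ (held (after-push run))
    ... | inj₂ has = inj₂ (has-mono (⊆-trans (refl ∷ P₁⊆) sub) has)
    go (outer d d∉ d∉P d≢a d⊆) = framed d d∉ d∉P (⊆-trans (refl ∷ a ∷ʳ ⊆-refl) d⊆)
    go (inner d d∉ d∉P d≢a d⊆ _) = framed d d∉ d∉P (⊆-trans (a ∷ʳ ⊆-refl) d⊆)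

  -- In the outer case the latest colour over `b` yields `I₁`. In the inner case `b` recurs in `P`;
  -- the latest colour over its last sock there either was stacked in `B`, which gives `I₂` with
  -- `d`, or was read later, which is the situation of `blocked`.
  uncut : ∀ {b B P} → b ≢ u → Context (b ∷ B) P → Unique (b ∷ B) → a ∉ b ∷ B → a ∉ P →
    a ∷ (b ∷ B) ++ P ++ a ∷ R ⊆ X → (∀ {c} → c ∈ (b ∷ B) ++ P → c ∈ R → c ≡ u) →
    NoCuts b B P R → Has X
  uncut b≢u (single refl) _ _ _ _ _ noCuts with noCuts [] _ refl
  ... | c , _ , () , _
  uncut {b} {B} {P} b≢u (outer d d∉ d∉P d≢a d⊆) (b∉ ∷ _) a∉ a∉P _ _ noCuts
    with latest b B P R (subst (λ L → NoCut b L (P ++ R)) (++-identityʳ B) (noCuts [] P refl))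
  ... | t , t≢b , t∈B , lat =
    has-mono (⊆-trans (refl ∷ refl ∷ refl ∷ pick t∈B (refl ∷ embeds-in)) d⊆)
      (I₁ {a} {b} {d} {t} {rungs}
        ((a∉ ∘ here ∷ d≢a ∘ sym ∷ (λ { refl → a∉ (there t∈B) }) ∷ []) ∷
         ((λ { refl → d∉ (here refl) }) ∷ t≢b ∘ sym ∷ []) ∷ ((λ { refl → d∉ (there t∈B) }) ∷ []) ∷
             [] ∷ [])
        unique
        (λ i → avoids-list (∈⇒≢ (inside i) a∉P ∷ avoids i ∷ ∈⇒≢ (inside i) d∉P ∷
            (λ { refl → unseen i t∈B }) ∷ [])))
    where
    open Chain (chain (length P) a b B P R ≤-refl t≢b t∈B noCuts lat)
  uncut {b} {B} {P} b≢u (inner d d∉ d∉P d≢a d⊆ head∈) (b∉ ∷ _) a∉ a∉P sub crossing noCuts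
    with ∈-++⁻ P (head∈ refl)
  ... | inj₂ b∈R = ⊥-elim (b≢u (crossing (here refl) b∈R))
  ... | inj₁ b∈P with last P b∈P
  ...   | P₁ , P₂ , refl , b∉P₂ =
    stuck (latest b Q P₂ R (noCut-map (λ _ → subst (_ ∈_) (++-identityʳ Q)) (λ _ → id)
        (noCut′ [] P₂ refl)))
    where
    Q : SockOrdering
    Q = B ++ P₁
    noCut′ : ∀ V₁ V₂ → P₂ ≡ V₁ ++ V₂ → NoCut b (Q ++ V₁) (V₂ ++ R)
    noCut′ V₁ V₂ refl = noCut-map (λ c≢b i → either (∈-++⁻ B i) (∈-++⁺ˡ ∘ ∈-++⁺ˡ)
        λ j → either (∈-++⁻ P₁ j) (∈-++⁺ˡ ∘ ∈-++⁺ʳ B) λ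
            { (here e) → ⊥-elim (c≢b e) ; (there k) → ∈-++⁺ʳ Q k })
      (λ _ → id) (noCuts (P₁ ++ b ∷ V₁) V₂ (sym (++-assoc P₁ (b ∷ V₁) V₂)))
    whole : a ∷ b ∷ Q ++ b ∷ P₂ ++ a ∷ R ⊆ X
    whole = subst (_⊆ X) (cong (λ W → a ∷ b ∷ W)
      (trans (cong (B ++_) (++-assoc P₁ (b ∷ P₂) (a ∷ R))) (sym (++-assoc B P₁ _)))) sub
    a∉Q : a ∉ Q
    a∉Q i = either (∈-++⁻ B i) (a∉ ∘ there) (a∉P ∘ ∈-++⁺ˡ)
    a∉P₂ : a ∉ P₂
    a∉P₂ = a∉P ∘ ∈-++⁺ʳ P₁ ∘ there
    crossing′ : ∀ {c} → c ∈ Q → c ∈ R → c ≡ u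
    crossing′ i = crossing (there (either (∈-++⁻ B i) ∈-++⁺ˡ (∈-++⁺ʳ B ∘ ∈-++⁺ˡ)))
    stuck : ∃ (λ s → s ≢ b × s ∈ Q × Latest b Q P₂ R s) → Has X
    stuck (s , s≢b , s∈Q , lat) with s ∈? B
    ... | yes s∈B =
      has-mono (⊆-trans (refl ∷ refl ∷ refl ∷ pick s∈B
          (refl ∷ subst (b ∷ ladder s rungs a ⊆_) (sym (++-assoc P₁ (b ∷ P₂) (a ∷ R)))
          (++⁺ˡ P₁ (refl ∷ embeds-in)))) d⊆)
        (I₂ {a} {b} {d} {s} {rungs}
          ((a∉ ∘ here ∷ d≢a ∘ sym ∷ (λ { refl → a∉ (there s∈B) }) ∷ []) ∷
           ((λ { refl → d∉ (here refl) }) ∷ s≢b ∘ sym ∷ []) ∷ ((λ { refl → d∉ (there s∈B) }) ∷ []) ∷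
               [] ∷ [])
          unique
          (λ i → avoids-list (∈⇒≢ (inside i) a∉P₂ ∷ avoids i ∷
            ∈⇒≢ (inside i) (d∉P ∘ ∈-++⁺ʳ P₁ ∘ there) ∷ (λ { refl → unseen i s∈Q }) ∷ [])))
      where
      open Chain (chain (length P₂) a b Q P₂ R ≤-refl s≢b s∈Q noCut′ lat)
    ... | no s∉B with first P₁ (either (∈-++⁻ B s∈Q) (⊥-elim ∘ s∉B) id)
    ...   | Q₁ , Q₂ , refl , s∉Q₁ = has-mono whole
      (blocked (a∉ ∘ here) a∉Q a∉P₂
        (λ _ _ i j k l → trans (crossing′ i k) (sym (crossing′ j l)))
        noCut′ s≢b lat (sym (++-assoc B Q₁ (s ∷ Q₂)))
        (λ i → either (∈-++⁻ B i) s∉B s∉Q₁)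
        (inj₁ (noCut-map (λ _ → id) (λ c≢b → λ
            { (here e) → here e ; (there i) → there (either (∈-++⁻ Q₂ i) ∈-++⁺ˡ
            λ { (here e) → ⊥-elim (c≢b e) ; (there j) → ∈-++⁺ʳ Q₂ j }) })
          (map-∈ (noCuts Q₁ (s ∷ Q₂ ++ b ∷ P₂) (++-assoc Q₁ (s ∷ Q₂) (b ∷ P₂)))))))
      where
      map-∈ : NoCut b (B ++ Q₁) ((s ∷ Q₂ ++ b ∷ P₂) ++ R) → NoCut b (B ++ Q₁)
          (s ∷ Q₂ ++ b ∷ P₂ ++ R)
      map-∈ = subst (NoCut b (B ++ Q₁)) (cong (s ∷_) (++-assoc Q₂ (b ∷ P₂) R))

  -- The bottom colour b of C must be output before the a after P. It may wait until the
  -- last cut of P; then it has to be output, and what is pushed meanwhile replaces C.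
  phase : ∀ k C P → length P ≤ k → length C + suc (length P) ≤ n → Unique C → a ∉ C → a ∉ P →
    Context C P → a ∷ C ++ P ++ a ∷ R ⊆ X → NoCuts a C P R →
    (∀ {c} → c ∈ C ++ P → c ∈ R → c ≡ u) → Run nothing (reverse C) P [ u ] ⊎ Has X
  phase k [] P _ _ _ _ _ _ _ noCuts _ with noCuts [] P refl
  ... | _ , _ , () , _
  phase k (b ∷ B) P lk len uC a∉C a∉P ctx sub noCuts crossing with b ≟ u
  -- The crossing colour is already at the bottom: it is kept through all of `P`, and a sock of `R`
  -- serves as the appended one.
  ... | yes refl = hold-bottom P uC len ctx (⊆-trans (a ∷ʳ ⊆-refl) sub)
          (++⁺ (⊆-refl {x = P}) (a ∷ʳ from∈ u∈R)) id
  ... | no b≢u with lastCut b B P R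
  ...   | inj₂ noCuts-b = inj₂ (uncut b≢u ctx uC a∉C a∉P sub crossing noCuts-b)
  phase k (b ∷ B) P lk len uC a∉C a∉P ctx sub noCuts crossing | no b≢u
      | inj₁ record { before = P₁ ; after = P₂ ; split = refl ; cut = cut ; noCutAfter = noCutAfter
          } =
    go k lk (last P₂ b∈P₂)
    where
    b∉R : b ∉ R
    b∉R = b≢u ∘ crossing (here refl)
    -- There is a cut for `b` here but none for `a`, so the straddling colour is `b` itself.
    b∈P₂ : b ∈ P₂
    b∈P₂ with noCuts P₁ P₂ refl
    ... | c , _ , c∈ , c∈′ with c ≟ b
    ...   | yes refl = either (∈-++⁻ P₂ c∈′) id (⊥-elim ∘ b∉R)
    b∈P₂ | c , _ , here e , c∈′ | no c≢b = ⊥-elim (c≢b e)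
    b∈P₂ | c , _ , there c∈ , c∈′ | no c≢b = ⊥-elim (cut c≢b c∈ c∈′)
    earlier : ∀ {c} → c ≢ b → c ∈ (b ∷ B) ++ P₁ → c ∉ P₂ ++ R
    earlier c≢b (here e) = ⊥-elim (c≢b e)
    earlier c≢b (there i) = cut c≢b i
    go : ∀ k → length (P₁ ++ P₂) ≤ k → ∃₂ (λ P₃ P₄ → P₂ ≡ P₃ ++ b ∷ P₄ × b ∉ P₄) →
      Run nothing (reverse (b ∷ B)) (P₁ ++ P₂) [ u ] ⊎ Has X
    go k lk (P₃ , P₄ , refl , b∉P₄) =
      [ with-hold , inj₂ ]′ (hold-bottom P₁ uC
        (≤-trans (+-monoʳ-≤ (suc (length B)) (s≤s
            (≤-trans (m≤m+n (length P₁) _) (≤-reflexive (sym (length-++ P₁)))))) len)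
        ctx (⊆-trans (a ∷ʳ ⊆-refl) sub)
        (subst (P₁ ++ [ b ] ⊆_) (sym (++-assoc P₁ (P₃ ++ b ∷ P₄) (a ∷ R)))
          (++⁺ (⊆-refl {x = P₁}) (++⁺ʳ (a ∷ R) (from∈ (middle P₃)))))
        ∈-++⁺ˡ)
      where
      P₂R : P₂ ++ R ≡ P₃ ++ b ∷ P₄ ++ R
      P₂R = ++-assoc P₃ (b ∷ P₄) R
      whole : a ∷ b ∷ P₃ ++ b ∷ P₄ ++ a ∷ R ⊆ X
      whole = ⊆-trans (refl ∷ refl ∷ ++⁺ˡ B (subst (_ ⊆_) (sym (++-assoc P₁ (P₃ ++ b ∷ P₄) (a ∷ R)))
        (++⁺ˡ P₁ (⊆-reflexive (sym (++-assoc P₃ (b ∷ P₄) (a ∷ R))))))) sub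
      in-P : ∀ {c} → c ∈ P₃ ++ b ∷ P₄ → c ∈ (b ∷ B) ++ (P₁ ++ (P₃ ++ b ∷ P₄))
      in-P i = ∈-++⁺ʳ (b ∷ B) (∈-++⁺ʳ P₁ i)
      a∉P₃ : a ∉ P₃
      a∉P₃ = a∉P ∘ ∈-++⁺ʳ P₁ ∘ ∈-++⁺ˡ
      a∉P₄ : a ∉ P₄
      a∉P₄ = a∉P ∘ ∈-++⁺ʳ P₁ ∘ ∈-++⁺ʳ P₃ ∘ there
      noCut₃ : ∀ V₁ V₂ {c} → P₃ ≡ V₁ ++ V₂ → c ∈ V₁ → NoCut b V₁ (V₂ ++ b ∷ P₄ ++ R)
      noCut₃ (v ∷ V₁) V₂ refl _ = subst (NoCut b (v ∷ V₁)) (++-assoc V₂ (b ∷ P₄) R)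
        (noCutAfter v V₁ (V₂ ++ b ∷ P₄) (cong (v ∷_) (++-assoc V₁ V₂ (b ∷ P₄))))
      noCut₄ : ∀ V₁ V₂ → P₄ ≡ V₁ ++ V₂ → NoCut b (P₃ ++ V₁) (V₂ ++ R)
      noCut₄ V₁ V₂ refl = noCut-map
          (λ c≢b i → either (∈-++⁻ P₃ i) ∈-++⁺ˡ λ
              { (here e) → ⊥-elim (c≢b e) ; (there j) → ∈-++⁺ʳ P₃ j })
          (λ _ → id) (nonempty P₃ (noCutAfter′))
        where
        nonempty : ∀ W → (∀ v V → W ++ b ∷ V₁ ≡ v ∷ V → NoCut b (v ∷ V) (V₂ ++ R)) → NoCut b
            (W ++ b ∷ V₁) (V₂ ++ R)
        nonempty [] f = f b V₁ refl
        nonempty (w ∷ W) f = f w (W ++ b ∷ V₁) refl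
        noCutAfter′ : ∀ v V → P₃ ++ b ∷ V₁ ≡ v ∷ V → NoCut b (v ∷ V) (V₂ ++ R)
        noCutAfter′ v V e = noCutAfter v V V₂ (trans (sym (++-assoc P₃ (b ∷ V₁) V₂))
            (cong (_++ V₂) e))
      crossing₃ : ∀ {c} → c ∈ P₃ → c ∈ R → c ≡ u
      crossing₃ i = crossing (in-P (∈-++⁺ˡ i))
      -- Outputting `b` from the last cut on would stack `P₃`, which the sandwich forbids; the uncut
      -- rest `P₄` supplies the chain.
      sandwiched : Sandwich b P₃ → Has X
      sandwiched sw with latest b P₃ P₄ R (noCut-map (λ _ → subst (_ ∈_) (++-identityʳ P₃))
          (λ _ → id) (noCut₄ [] P₄ refl))
      ... | s , s≢b , s∈ , lat with first P₃ s∈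
      ...   | Q₁ , Q₂ , eq , s∉Q₁ = has-mono whole
        (blocked (a∉C ∘ here) a∉P₃ a∉P₄ (λ _ _ i j k l → trans (crossing₃ i k)
            (sym (crossing₃ j l)))
          noCut₄ s≢b lat eq s∉Q₁ (start Q₁ eq))
        where
        start : ∀ Q₁ → P₃ ≡ Q₁ ++ s ∷ Q₂ → NoCut b Q₁ (s ∷ Q₂ ++ P₄ ++ R) ⊎
            (Q₁ ≡ [] × Sandwich b P₃)
        start [] _ = inj₂ (refl , sw)
        start (q ∷ Q₁) e = inj₁ (noCut-map (λ _ → id)
          (λ { c≢b (here e) → here e
             ; c≢b (there i) → there (either (∈-++⁻ Q₂ i) ∈-++⁺ˡ
                 λ { (here e) → ⊥-elim (c≢b e) ; (there j) → ∈-++⁺ʳ Q₂ j }) })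
          (noCut₃ (q ∷ Q₁) (s ∷ Q₂) e (here refl)))
      with-hold : Run nothing (reverse (b ∷ B)) P₁ [ b ] →
        Run nothing (reverse (b ∷ B)) (P₁ ++ P₂) [ u ] ⊎ Has X
      with-hold hold with skip-constant b P₃
      -- If `P₃` consisted of socks `b` only, nothing could straddle the position after the last
      -- `b`.
      ... | inj₁ all with noCuts (P₁ ++ P₃ ++ [ b ]) P₄
             (trans (cong (P₁ ++_) (sym (++-assoc P₃ [ b ] P₄)))
                 (sym (++-assoc P₁ (P₃ ++ [ b ]) P₄)))
      ...   | c , _ , c∈ , c∈′ = ⊥-elim (c≢b (either (∈-++⁻ (b ∷ B) c∈)
          (λ i → ⊥-elim (earlier c≢b (∈-++⁺ˡ i) c∈″))
                λ j → either (∈-++⁻ P₁ j) (λ i → ⊥-elim (earlier c≢b (∈-++⁺ʳ (b ∷ B) i) c∈″))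
                λ l → either (∈-++⁻ P₃ l) (All.lookup all) λ { (here e) → e }))
        where
        c≢b : c ≢ b
        c≢b refl = either (∈-++⁻ P₄ c∈′) b∉P₄ b∉R
        c∈″ : c ∈ P₂ ++ R
        c∈″ = subst (c ∈_) (sym P₂R) (∈-++⁺ʳ P₃ (there c∈′))
      with-hold hold | inj₂ (bs , h , Z , refl , all , h≢b) with pushing b [ h ] Z ([] ∷ [])
          (λ { (here e) → h≢b (sym e) })
      ... | inj₂ (x , y , x≢y , x≢b , y≢b , xyx⊆) = inj₂
          (sandwiched (x , y , x≢y , x≢b , y≢b , ++⁺ˡ bs xyx⊆))
      ... | inj₁ pushed with h ∈? P₄ ++ R
      -- `h` has to recur after the last `b`: otherwise a colour `c` straddling the last `h` would
      -- lie between two socks `h`, giving the sandwich h c h.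
      ...   | no h∉ with last (h ∷ Z) (here refl)
      ...     | Z₁ , Z₂ , eq , h∉Z₂ with noCut₃ (bs ++ Z₁ ++ [ h ]) Z₂
                  (trans (cong (bs ++_) (trans eq (sym (++-assoc Z₁ [ h ] Z₂))))
                      (sym (++-assoc bs (Z₁ ++ [ h ]) Z₂)))
                  (∈-++⁺ʳ bs (middle Z₁))
      ...       | c , c≢b , c∈ , c∈′ = inj₂ (again (∈-++⁻ bs c∈))
        where
        c≢h : c ≢ h
        c≢h refl = either (∈-++⁻ Z₂ c∈′) h∉Z₂ λ { (here e) → h≢b e ; (there i) → h∉ i }
        inside-Z : ∀ Z₁ → h ∷ Z ≡ Z₁ ++ h ∷ Z₂ → c ∈ Z₁ → Has X
        inside-Z (z ∷ Z₁) refl (here e) = ⊥-elim (c≢h e)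
        inside-Z (z ∷ Z₁) refl (there i) = sandwiched (h , c , c≢h ∘ sym , h≢b , c≢b ,
          ++⁺ˡ bs (refl ∷ pick i (refl ∷ minimum Z₂)))
        again : c ∈ bs ⊎ c ∈ Z₁ ++ [ h ] → Has X
        again (inj₁ i) = ⊥-elim (c≢b (All.lookup all i))
        again (inj₂ i) = either (∈-++⁻ Z₁ i) (inside-Z Z₁ eq) λ { (here e) → ⊥-elim (c≢h e) }
      with-hold hold | inj₂ (bs , h , Z , refl , all , h≢b) | inj₁ pushed | yes h∈ = recur k lk
        where
        open Pushed pushed
        C′ : SockOrdering
        C′ = h ∷ reverse layers
        rev : reverse C′ ≡ layers ++ [ h ]
        rev = trans (unfold-reverse h (reverse layers))
            (cong (_++ [ h ]) (reverse-involutive layers))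
        C′⊆ : C′ ⊆ bs ++ h ∷ Z
        C′⊆ = ++⁺ˡ bs (refl ∷ layers⊆)
        b∉C′ : b ∉ C′
        b∉C′ (here e) = h≢b (sym e)
        b∉C′ (there i) = fresh-u (reverse⁻ {xs = layers} i)
        resume-b : Run nothing (reverse C′) P₄ [ u ] → Run nothing [ b ] P₂ [ u ]
        resume-b run = begin (subst (λ W → Run (just b) [] W [ u ])
            (sym (++-assoc bs (h ∷ Z) (b ∷ P₄)))
          (emits bs all (push (λ ()) (resume (emit (close b∉layers b∉P₄
            (subst (λ S → Run nothing S P₄ [ u ]) rev run)))))))
          where
          b∉layers : b ∉ layers ++ [ h ]
          b∉layers i = either (∈-++⁻ layers i) fresh-u λ { (here e) → h≢b (sym e) }
        assemble : Run nothing (reverse C′) P₄ [ u ] → Run nothing (reverse (b ∷ B)) (P₁ ++ P₂) [ u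
            ]
        assemble run = subst (λ S → Run nothing S (P₁ ++ P₂) [ u ]) (++-identityʳ (reverse (b ∷ B)))
          (run-++ {D = []} hold (resume-b run) (λ _ ())
            λ { {c} i c∈P₂ → keep (c ≟ b) i c∈P₂ })
          where
          keep : ∀ {c} → Dec (c ≡ b) → Present nothing (reverse (b ∷ B)) P₁ c → c ∈ P₂ → c ∈ [ b ]
          keep (yes e) _ _ = here e
          keep (no c≢b) (inj₁ i) c∈P₂ = ⊥-elim
              (earlier c≢b (∈-++⁺ˡ (reverse⁻ {xs = b ∷ B} i)) (∈-++⁺ˡ c∈P₂))
          keep (no c≢b) (inj₂ (inj₁ i)) c∈P₂ = ⊥-elim (earlier c≢b (∈-++⁺ʳ (b ∷ B) i) (∈-++⁺ˡ c∈P₂))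
        unique′ : Unique C′
        unique′ = subst Unique (trans (reverse-++ layers [ h ]) refl) (unique-reverse unique)
        noCuts′ : NoCuts a C′ P₄ R
        noCuts′ V₁ V₂ refl with noCuts (P₁ ++ P₃ ++ b ∷ V₁) V₂
          (trans (cong (P₁ ++_) (sym (++-assoc P₃ (b ∷ V₁) V₂)))
              (sym (++-assoc P₁ (P₃ ++ b ∷ V₁) V₂)))
        ... | c , c≢a , c∈ , c∈′ = c , c≢a , either (∈-++⁻ (b ∷ B) c∈)
            (λ i → ⊥-elim (earlier c≢b (∈-++⁺ˡ i) c∈″))
                (λ j → either (∈-++⁻ P₁ j) (λ i → ⊥-elim (earlier c≢b (∈-++⁺ʳ (b ∷ B) i) c∈″))
                λ l → either (∈-++⁻ P₃ l) (∈-++⁺ˡ ∘ stacked) λ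
                    { (here e) → ⊥-elim (c≢b e) ; (there i) → ∈-++⁺ʳ C′ i }) , c∈′
          where
          c≢b : c ≢ b
          c≢b refl = either (∈-++⁻ V₂ c∈′) (b∉P₄ ∘ ∈-++⁺ʳ V₁) b∉R
          c∈″ : c ∈ P₂ ++ R
          c∈″ = subst (c ∈_) (sym P₂R) (∈-++⁺ʳ P₃
              (there (subst (c ∈_) (sym (++-assoc V₁ V₂ R)) (∈-++⁺ʳ V₁ c∈′))))
          stacked : c ∈ bs ++ h ∷ Z → c ∈ C′
          stacked i with ∈-++⁻ bs i
          ... | inj₁ j = ⊥-elim (c≢b (All.lookup all j))
          ... | inj₂ (here e) = here e
          ... | inj₂ (there j) with ∈-++⁻ layers (covers j c≢b)
          ...   | inj₁ l = there (reverse⁺ l)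
          ...   | inj₂ (here e) = here e
        crossing′ : ∀ {c} → c ∈ C′ ++ P₄ → c ∈ R → c ≡ u
        crossing′ i = crossing (in-P (either (∈-++⁻ C′ i) (∈-++⁺ˡ ∘ lookup C′⊆)
            (∈-++⁺ʳ P₃ ∘ there)))
        context′ : Context C′ P₄
        context′ = inner b b∉C′ b∉P₄ (λ { refl → a∉C (here refl) })
          (⊆-trans (refl ∷ refl ∷ ++⁺ C′⊆ ⊆-refl) whole) λ { refl → h∈ }
        length-P : length P₃ + suc (length P₄) ≤ length (P₁ ++ P₂)
        length-P = ≤-trans (≤-reflexive (sym (length-++ P₃)))
          (≤-trans (m≤n+m (length P₂) (length P₁)) (≤-reflexive (sym (length-++ P₁))))
        recur : ∀ k → length (P₁ ++ P₂) ≤ k → Run nothing (reverse (b ∷ B)) (P₁ ++ P₂) [ u ] ⊎ Has X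
        recur zero lk with ≤-trans (≤-trans (m≤n+m (suc (length P₄)) (length P₃)) length-P) lk
        ... | ()
        recur (suc k) lk with phase k C′ P₄
          (s≤s⁻¹ (≤-trans (≤-trans (m≤n+m (suc (length P₄)) (length P₃)) length-P) lk))
          (≤-trans (+-mono-≤ (length-mono-≤ C′⊆) (≤-refl {suc (length P₄)}))
            (≤-trans length-P (≤-trans (≤-trans (n≤1+n _) (m≤n+m _ (suc (length B)))) len)))
          unique′ (a∉P₃ ∘ lookup C′⊆) a∉P₄ context′
          (⊆-trans (refl ∷ b ∷ʳ ++⁺ C′⊆ (b ∷ʳ ⊆-refl)) whole) noCuts′ crossing′
        ... | inj₁ run = inj₁ (assemble run)
        ... | inj₂ has = inj₂ has

-- Finite cases for a first sock that cannot be output at once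

certificate-unique : (cs : List Color) (t : Template) →
  {T (check patterns 0 0 (upTo (length cs)) [] t)} → Unique cs →
  ∀ {Zs} → Fits (nth cs) t Zs → Has (concat Zs)
certificate-unique cs t {c} uniq fits = check-sound (nth cs) 0 0 (upTo (length cs)) [] t c
  (λ x∈ y∈ → nth-injective uniq (∈-upTo⁻ x∈) (∈-upTo⁻ y∈)) [] fits

word : (cs : List Color) (w : List ℕ) →
  {T (check patterns 0 0 (upTo (length cs)) [] ((w ∷ []) ∷ []))} → Unique cs →
  ∀ {X} → map (nth cs) w ⊆ X → Has X
word cs w {c} uniq {X} sub =
  subst Has (++-identityʳ X) (certificate-unique cs ((w ∷ []) ∷ []) {c} uniq {X ∷ []}
      ((sub ∷ []) ∷ []))

-- `x` and `y` may coincide with `b` or `u`, and `u` may stand anywhere relative to x y x; the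
-- template leaves all this open. In the primed version the sandwich starts with the `b` in front of
-- `Z`.
crossing-sandwich : ∀ {m b u x y Z W} → m ≢ b → m ≢ u → b ≢ u → m ≢ x → m ≢ y → x ≢ y →
  u ∈ Z → x ∷ y ∷ x ∷ [] ⊆ Z → b ∈ W → u ∈ W → Has (m ∷ b ∷ Z ++ m ∷ W)
crossing-sandwich {m} {b} {u} {x} {y} {Z} {W} mb mu bu mx my xy u∈Z sub b∈W u∈W =
  subst (λ V → Has (m ∷ b ∷ Z ++ m ∷ V)) (++-identityʳ W)
    (certificate (m ∷ b ∷ u ∷ x ∷ y ∷ [])
      ((0 , 1) ∷ (0 , 2) ∷ (1 , 2) ∷ (0 , 3) ∷ (0 , 4) ∷ (3 , 4) ∷ [])
      (((0 ∷ 1 ∷ []) ∷ []) ∷ ((2 ∷ []) ∷ (3 ∷ 4 ∷ 3 ∷ []) ∷ []) ∷ ((0 ∷ []) ∷ []) ∷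
          ((1 ∷ []) ∷ (2 ∷ []) ∷ []) ∷ [])
      (mb ∷ mu ∷ bu ∷ mx ∷ my ∷ xy ∷ [])
      {(m ∷ b ∷ []) ∷ Z ∷ [ m ] ∷ W ∷ []}
      ((⊆-refl ∷ []) ∷ (from∈ u∈Z ∷ sub ∷ []) ∷ (⊆-refl ∷ []) ∷ (from∈ b∈W ∷ from∈ u∈W ∷ []) ∷ []))

crossing-sandwich′ : ∀ {m b u y Z W} → m ≢ b → m ≢ u → b ≢ u → m ≢ y → b ≢ y →
  u ∈ Z → y ∷ b ∷ [] ⊆ Z → b ∈ W → u ∈ W → Has (m ∷ b ∷ Z ++ m ∷ W)
crossing-sandwich′ {m} {b} {u} {y} {Z} {W} mb mu bu my by u∈Z sub b∈W u∈W =
  subst (λ V → Has (m ∷ b ∷ Z ++ m ∷ V)) (++-identityʳ W)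
    (certificate (m ∷ b ∷ u ∷ y ∷ [])
      ((0 , 1) ∷ (0 , 2) ∷ (1 , 2) ∷ (0 , 3) ∷ (1 , 3) ∷ [])
      (((0 ∷ 1 ∷ []) ∷ []) ∷ ((2 ∷ []) ∷ (3 ∷ 1 ∷ []) ∷ []) ∷ ((0 ∷ []) ∷ []) ∷
          ((1 ∷ []) ∷ (2 ∷ []) ∷ []) ∷ [])
      (mb ∷ mu ∷ bu ∷ my ∷ by ∷ [])
      {(m ∷ b ∷ []) ∷ Z ∷ [ m ] ∷ W ∷ []}
      ((⊆-refl ∷ []) ∷ (from∈ u∈Z ∷ sub ∷ []) ∷ (⊆-refl ∷ []) ∷ (from∈ b∈W ∷ from∈ u∈W ∷ []) ∷ []))

-- The variant where `u` recurs before the last `m`: another `m` inside `Z` separates two socks `u`.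
repeated-sandwich : ∀ {m b u x y Z W} → m ≢ b → m ≢ u → b ≢ u → m ≢ x → m ≢ y → x ≢ y →
  u ∷ m ∷ u ∷ [] ⊆ Z → x ∷ y ∷ x ∷ [] ⊆ Z → b ∈ W → Has (m ∷ b ∷ Z ++ m ∷ W)
repeated-sandwich {m} {b} {u} {x} {y} {Z} {W} mb mu bu mx my xy umu sub b∈W =
  subst (λ V → Has (m ∷ b ∷ Z ++ m ∷ V)) (++-identityʳ W)
    (certificate (m ∷ b ∷ u ∷ x ∷ y ∷ [])
      ((0 , 1) ∷ (0 , 2) ∷ (1 , 2) ∷ (0 , 3) ∷ (0 , 4) ∷ (3 , 4) ∷ [])
      (((0 ∷ 1 ∷ []) ∷ []) ∷ ((2 ∷ 0 ∷ 2 ∷ []) ∷ (3 ∷ 4 ∷ 3 ∷ []) ∷ []) ∷ ((0 ∷ []) ∷ []) ∷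
          ((1 ∷ []) ∷ []) ∷ [])
      (mb ∷ mu ∷ bu ∷ mx ∷ my ∷ xy ∷ [])
      {(m ∷ b ∷ []) ∷ Z ∷ [ m ] ∷ W ∷ []}
      ((⊆-refl ∷ []) ∷ (umu ∷ sub ∷ []) ∷ (⊆-refl ∷ []) ∷ (from∈ b∈W ∷ []) ∷ []))

repeated-sandwich′ : ∀ {m b u y Z W} → m ≢ b → m ≢ u → b ≢ u → m ≢ y → b ≢ y →
  u ∷ m ∷ u ∷ [] ⊆ Z → y ∷ b ∷ [] ⊆ Z → b ∈ W → Has (m ∷ b ∷ Z ++ m ∷ W)
repeated-sandwich′ {m} {b} {u} {y} {Z} {W} mb mu bu my by umu sub b∈W =
  subst (λ V → Has (m ∷ b ∷ Z ++ m ∷ V)) (++-identityʳ W)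
    (certificate (m ∷ b ∷ u ∷ y ∷ [])
      ((0 , 1) ∷ (0 , 2) ∷ (1 , 2) ∷ (0 , 3) ∷ (1 , 3) ∷ [])
      (((0 ∷ 1 ∷ []) ∷ []) ∷ ((2 ∷ 0 ∷ 2 ∷ []) ∷ (3 ∷ 1 ∷ []) ∷ []) ∷ ((0 ∷ []) ∷ []) ∷
          ((1 ∷ []) ∷ []) ∷ [])
      (mb ∷ mu ∷ bu ∷ my ∷ by ∷ [])
      {(m ∷ b ∷ []) ∷ Z ∷ [ m ] ∷ W ∷ []}
      ((⊆-refl ∷ []) ∷ (umu ∷ sub ∷ []) ∷ (⊆-refl ∷ []) ∷ (from∈ b∈W ∷ []) ∷ []))

-- From the stack a u, the colour u cannot be output completely: before its last sock in R
-- there is a sandwich, which may use the stacked a.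
Obstructed : (a u : Color) (R : SockOrdering) → Set
Obstructed a u R =
  (∃₂ λ x y → x ≢ y × x ≢ u × y ≢ u × x ≢ a × y ≢ a × x ∷ y ∷ x ∷ u ∷ [] ⊆ R) ⊎
  (∃ λ y → y ≢ u × y ≢ a × y ∷ a ∷ u ∷ [] ⊆ R)

-- The sandwich x y x before a later `m` forbids outputting `m` at once, and the obstruction of `b`,
-- which lies on `m`, defeats keeping it.
nested-sandwich : ∀ {m b x y P R} → m ≢ b → m ≢ x → m ≢ y → x ≢ y →
  Obstructed m b R → x ∷ y ∷ x ∷ m ∷ [] ⊆ P ++ m ∷ R → Has (m ∷ b ∷ P ++ m ∷ R)
nested-sandwich {m} {b} {x} {y} {P} {R} mb mx my xy (inj₁ (p , q , pq , pb , qb , pm , qm , sub))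
    sub′ =
  subst (λ V → Has (m ∷ b ∷ V)) (++-identityʳ (P ++ m ∷ R))
    (certificate (m ∷ b ∷ p ∷ q ∷ x ∷ y ∷ [])
      ((0 , 1) ∷ (0 , 2) ∷ (0 , 3) ∷ (1 , 2) ∷ (1 , 3) ∷ (2 , 3) ∷ (0 , 4) ∷ (0 , 5) ∷ (4 , 5) ∷ [])
      (((0 ∷ 1 ∷ []) ∷ []) ∷ ((0 ∷ 2 ∷ 3 ∷ 2 ∷ 1 ∷ []) ∷ (4 ∷ 5 ∷ 4 ∷ 0 ∷ []) ∷ []) ∷ [])
      (mb ∷ pm ∘ sym ∷ qm ∘ sym ∷ pb ∘ sym ∷ qb ∘ sym ∷ pq ∷ mx ∷ my ∷ xy ∷ [])
      {(m ∷ b ∷ []) ∷ (P ++ m ∷ R) ∷ []}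
      ((⊆-refl ∷ []) ∷ (++⁺ˡ P (refl ∷ sub) ∷ sub′ ∷ []) ∷ []))
nested-sandwich {m} {b} {x} {y} {P} {R} mb mx my xy (inj₂ (r , rb , rm , sub)) sub′ =
  subst (λ V → Has (m ∷ b ∷ V)) (++-identityʳ (P ++ m ∷ R))
    (certificate (m ∷ b ∷ r ∷ x ∷ y ∷ [])
      ((0 , 1) ∷ (0 , 2) ∷ (1 , 2) ∷ (0 , 3) ∷ (0 , 4) ∷ (3 , 4) ∷ [])
      (((0 ∷ 1 ∷ []) ∷ []) ∷ ((0 ∷ 2 ∷ 0 ∷ 1 ∷ []) ∷ (3 ∷ 4 ∷ 3 ∷ 0 ∷ []) ∷ []) ∷ [])
      (mb ∷ rm ∘ sym ∷ rb ∘ sym ∷ mx ∷ my ∷ xy ∷ [])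
      {(m ∷ b ∷ []) ∷ (P ++ m ∷ R) ∷ []}
      ((⊆-refl ∷ []) ∷ (++⁺ˡ P (refl ∷ sub) ∷ sub′ ∷ []) ∷ []))

nested-sandwich′ : ∀ {m b y P R} → m ≢ b → m ≢ y → b ≢ y →
  Obstructed m b R → y ∷ b ∷ m ∷ [] ⊆ P ++ m ∷ R → Has (m ∷ b ∷ P ++ m ∷ R)
nested-sandwich′ {m} {b} {y} {P} {R} mb my by (inj₁ (p , q , pq , pb , qb , pm , qm , sub)) sub′ =
  subst (λ V → Has (m ∷ b ∷ V)) (++-identityʳ (P ++ m ∷ R))
    (certificate (m ∷ b ∷ p ∷ q ∷ y ∷ [])
      ((0 , 1) ∷ (0 , 2) ∷ (0 , 3) ∷ (1 , 2) ∷ (1 , 3) ∷ (2 , 3) ∷ (0 , 4) ∷ (1 , 4) ∷ [])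
      (((0 ∷ 1 ∷ []) ∷ []) ∷ ((0 ∷ 2 ∷ 3 ∷ 2 ∷ 1 ∷ []) ∷ (4 ∷ 1 ∷ 0 ∷ []) ∷ []) ∷ [])
      (mb ∷ pm ∘ sym ∷ qm ∘ sym ∷ pb ∘ sym ∷ qb ∘ sym ∷ pq ∷ my ∷ by ∷ [])
      {(m ∷ b ∷ []) ∷ (P ++ m ∷ R) ∷ []}
      ((⊆-refl ∷ []) ∷ (++⁺ˡ P (refl ∷ sub) ∷ sub′ ∷ []) ∷ []))
nested-sandwich′ {m} {b} {y} {P} {R} mb my by (inj₂ (r , rb , rm , sub)) sub′ =
  subst (λ V → Has (m ∷ b ∷ V)) (++-identityʳ (P ++ m ∷ R))
    (certificate (m ∷ b ∷ r ∷ y ∷ [])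
      ((0 , 1) ∷ (0 , 2) ∷ (1 , 2) ∷ (0 , 3) ∷ (1 , 3) ∷ [])
      (((0 ∷ 1 ∷ []) ∷ []) ∷ ((0 ∷ 2 ∷ 0 ∷ 1 ∷ []) ∷ (3 ∷ 1 ∷ 0 ∷ []) ∷ []) ∷ [])
      (mb ∷ rm ∘ sym ∷ rb ∘ sym ∷ my ∷ by ∷ [])
      {(m ∷ b ∷ []) ∷ (P ++ m ∷ R) ∷ []}
      ((⊆-refl ∷ []) ∷ (++⁺ˡ P (refl ∷ sub) ∷ sub′ ∷ []) ∷ []))

-- Colours crossing the next a

-- The colours that are present on both sides of a sock a read between P and R.
data Crossings (C P R : SockOrdering) : Set where
  one : ∀ {u} → u ∈ C ++ P → u ∈ R → (∀ {c} → c ∈ C ++ P → c ∈ R → c ≡ u) →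
    u ∈ C ⊎ (u ∉ C × u ∈ P) → Crossings C P R
  stacked : ∀ {u v} → v ∈ C → v ∈ R → u ∈ C ++ P → u ∈ R → u ≢ v → Crossings C P R
  pushed : ∀ {u v} P₁ P₂ → P ≡ P₁ ++ v ∷ P₂ → (∀ {c} → c ∈ C ++ P₁ → c ∉ R) → v ∈ R →
    u ∈ P₂ → u ∈ R → u ≢ v → Crossings C P R

first-in : ∀ P R → (∀ {c : Color} → c ∈ P → c ∉ R) ⊎
  ∃₂ λ P₁ v → ∃ λ P₂ → P ≡ P₁ ++ v ∷ P₂ × (∀ {c} → c ∈ P₁ → c ∉ R) × v ∈ R
first-in [] R = inj₁ λ ()
first-in (p ∷ P) R with p ∈? R
... | yes p∈R = inj₂ ([] , p , P , refl , (λ ()) , p∈R)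
... | no p∉R with first-in P R
...   | inj₁ none = inj₁ λ { (here refl) → p∉R ; (there i) → none i }
...   | inj₂ (P₁ , v , P₂ , refl , none , v∈R) =
  inj₂ (p ∷ P₁ , v , P₂ , refl , (λ { (here refl) → p∉R ; (there i) → none i }) , v∈R)

crossings : ∀ {a} C P R → NoCuts a C P R → Crossings C P R
crossings {a} C P R noCuts with first-in C R
... | inj₂ (C₁ , v , C₂ , refl , _ , v∈R) with cut? v (C ++ P) R
...   | inj₂ (u , u≢v , u∈ , u∈R) = stacked (middle C₁) v∈R u∈ u∈R u≢v
...   | inj₁ cut = one (∈-++⁺ˡ (middle C₁)) v∈R only (inj₁ (middle C₁))
  where
  only : ∀ {c} → c ∈ C ++ P → c ∈ R → c ≡ v
  only {c} c∈ c∈R with c ≟ v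
  ... | yes e = e
  ... | no c≢v = ⊥-elim (cut c≢v c∈ c∈R)
crossings {a} C P R noCuts | inj₁ none with first-in P R
... | inj₁ none′ with noCuts P [] (sym (++-identityʳ P))
...   | c , _ , c∈ , c∈R = ⊥-elim (either (∈-++⁻ C c∈) (λ i → none i c∈R) (λ i → none′ i c∈R))
crossings {a} C P R noCuts | inj₁ none | inj₂ (P₁ , v , P₂ , refl , none′ , v∈R) with cut? v P₂ R
... | inj₂ (u , u≢v , u∈ , u∈R) = pushed P₁ P₂ refl
        (λ i c∈R → either (∈-++⁻ C i) (λ j → none j c∈R) (λ j → none′ j c∈R)) v∈R u∈ u∈R u≢v
... | inj₁ cut = one (∈-++⁺ʳ C (middle P₁)) v∈R only (inj₂ ((λ i → none i v∈R) , middle P₁))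
  where
  only : ∀ {c} → c ∈ C ++ (P₁ ++ v ∷ P₂) → c ∈ R → c ≡ v
  only {c} c∈ c∈R with c ≟ v | ∈-++⁻ C c∈
  ... | yes e | _ = e
  ... | no c≢v | inj₁ i = ⊥-elim (none i c∈R)
  ... | no c≢v | inj₂ i with ∈-++⁻ P₁ i
  ...   | inj₁ j = ⊥-elim (none′ j c∈R)
  ...   | inj₂ (here e) = e
  ...   | inj₂ (there j) = ⊥-elim (cut c≢v j c∈R)

-- t straddles the first v, and t v t makes a wait for both u and v.
two-pushed : ∀ {a u v C R} P₁ P₂ → a ∉ C → a ∉ P₁ ++ v ∷ P₂ → NoCuts a C (P₁ ++ v ∷ P₂) R →
  (∀ {c} → c ∈ C ++ P₁ → c ∉ R) → v ∈ R → u ∈ P₂ → u ∈ R → u ≢ v →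
  Has (a ∷ C ++ (P₁ ++ v ∷ P₂) ++ a ∷ R)
two-pushed {a} {u} {v} {C} {R} P₁ P₂ a∉C a∉P noCuts none v∈R u∈P₂ u∈R u≢v
  with noCuts P₁ (v ∷ P₂) refl
... | t , t≢a , t∈ , here refl = ⊥-elim (none t∈ v∈R)
... | t , t≢a , t∈ , there t∈′ =
  subst Has shape (certificate-unique (a ∷ t ∷ u ∷ v ∷ [])
    (((0 ∷ 1 ∷ 3 ∷ []) ∷ []) ∷ ((1 ∷ []) ∷ (2 ∷ []) ∷ []) ∷ ((0 ∷ []) ∷ []) ∷
        ((2 ∷ []) ∷ (3 ∷ []) ∷ []) ∷ [])
    ((t≢a ∘ sym ∷ ∈⇒≢ (∈-++⁺ʳ P₁ (there u∈P₂)) a∉P ∘ sym ∷ ∈⇒≢ (middle P₁) a∉P ∘ sym ∷ []) ∷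
     ((λ { refl → none t∈ u∈R }) ∷ (λ { refl → none t∈ v∈R }) ∷ []) ∷ (u≢v ∷ []) ∷ [] ∷ [])
    {(a ∷ C ++ P₁ ++ [ v ]) ∷ P₂ ∷ [ a ] ∷ R ∷ []}
    (((refl ∷ subst (t ∷ v ∷ [] ⊆_) (++-assoc C P₁ [ v ]) (pick t∈ ⊆-refl)) ∷ []) ∷
     (from∈ t∈P₂ ∷ from∈ u∈P₂ ∷ []) ∷ (⊆-refl ∷ []) ∷ (from∈ u∈R ∷ from∈ v∈R ∷ []) ∷ []))
  where
  t∈P₂ : t ∈ P₂
  t∈P₂ = either (∈-++⁻ P₂ t∈′) id (⊥-elim ∘ none t∈)
  shape : (a ∷ C ++ P₁ ++ [ v ]) ++ P₂ ++ a ∷ R ++ [] ≡ a ∷ C ++ (P₁ ++ v ∷ P₂) ++ a ∷ R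
  shape = cong (a ∷_) (trans (++-assoc C (P₁ ++ [ v ]) _) (cong (C ++_)
    (trans (++-assoc P₁ [ v ] _) (trans (cong (λ W → P₁ ++ v ∷ P₂ ++ a ∷ W) (++-identityʳ R))
      (sym (++-assoc P₁ (v ∷ P₂) (a ∷ R)))))))

-- Some `t` straddles the first `u` without reaching `R`, so a t u t a precedes the obstruction;
-- these letters together already contain a pattern.
obstructed-pushed : ∀ {a u C P R} → a ∉ C → a ∉ P → NoCuts a C P R →
  (∀ {c} → c ∈ C ++ P → c ∈ R → c ≡ u) → u ∈ R → u ∉ C → u ∈ P → Obstructed a u R →
  Has (a ∷ C ++ P ++ a ∷ R)
obstructed-pushed {a} {u} {C} {P} {R} a∉C a∉P noCuts only u∈R u∉C u∈P obs with first P u∈P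
... | P₁ , P₂ , refl , u∉P₁ with noCuts P₁ (u ∷ P₂) refl
...   | t , t≢a , t∈ , t∈′ = go obs
  where
  t≢u : t ≢ u
  t≢u refl = either (∈-++⁻ C t∈) u∉C u∉P₁
  t∉R : t ∉ R
  t∉R t∈R = t≢u (only (either (∈-++⁻ C t∈) ∈-++⁺ˡ (∈-++⁺ʳ C ∘ ∈-++⁺ˡ)) t∈R)
  t∈P₂ : t ∈ u ∷ P₂ ++ R → t ∈ P₂
  t∈P₂ (here e) = ⊥-elim (t≢u e)
  t∈P₂ (there i) = either (∈-++⁻ P₂ i) id (⊥-elim ∘ t∉R)
  a≢u : a ≢ u
  a≢u refl = a∉P (middle P₁)
  embed : ∀ {xs} → xs ⊆ R → a ∷ t ∷ u ∷ t ∷ a ∷ xs ⊆ a ∷ C ++ (P₁ ++ u ∷ P₂) ++ a ∷ R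
  embed s = refl ∷ subst (_ ⊆_) (trans (++-assoc C P₁ _)
      (cong (C ++_) (sym (++-assoc P₁ (u ∷ P₂) (a ∷ R)))))
    (pick t∈ (refl ∷ pick (t∈P₂ t∈′) (refl ∷ s)))
  go : Obstructed a u R → Has (a ∷ C ++ (P₁ ++ u ∷ P₂) ++ a ∷ R)
  go (inj₁ (x , y , x≢y , x≢u , y≢u , x≢a , y≢a , s)) =
    word (a ∷ t ∷ u ∷ x ∷ y ∷ []) (0 ∷ 1 ∷ 2 ∷ 1 ∷ 0 ∷ 3 ∷ 4 ∷ 3 ∷ 2 ∷ [])
      ((t≢a ∘ sym ∷ a≢u ∷ x≢a ∘ sym ∷ y≢a ∘ sym ∷ []) ∷
       (t≢u ∷ ∈⇒≢ (lookup s (here refl)) t∉R ∘ sym ∷ ∈⇒≢ (lookup s (there (here refl))) t∉R ∘ sym ∷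
           []) ∷
       (x≢u ∘ sym ∷ y≢u ∘ sym ∷ []) ∷ (x≢y ∷ []) ∷ [] ∷ [])
      (embed s)
  go (inj₂ (r , r≢u , r≢a , s)) =
    word (a ∷ t ∷ u ∷ r ∷ []) (0 ∷ 1 ∷ 2 ∷ 1 ∷ 0 ∷ 3 ∷ 0 ∷ 2 ∷ [])
      ((t≢a ∘ sym ∷ a≢u ∷ r≢a ∘ sym ∷ []) ∷
       (t≢u ∷ ∈⇒≢ (lookup s (here refl)) t∉R ∘ sym ∷ []) ∷ (r≢u ∘ sym ∷ []) ∷ [] ∷ [])
      (embed s)

-- Here the frame `m` replaces the straddling colour: m a u m a precedes the obstruction.
obstructed-stacked : ∀ {m a u C P R} → m ∉ a ∷ C → m ∉ R → a ∉ C → u ∈ C → Obstructed a u R →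
  Has (m ∷ (a ∷ C) ++ m ∷ P ++ a ∷ R)
obstructed-stacked {m} {a} {u} {C} {P} {R} m∉C m∉R a∉C u∈C obs = go obs
  where
  m≢a : m ≢ a
  m≢a = m∉C ∘ here
  m≢u : m ≢ u
  m≢u refl = m∉C (there u∈C)
  a≢u : a ≢ u
  a≢u refl = a∉C u∈C
  embed : ∀ {xs} → xs ⊆ R → m ∷ a ∷ u ∷ m ∷ a ∷ xs ⊆ m ∷ (a ∷ C) ++ m ∷ P ++ a ∷ R
  embed s = refl ∷ refl ∷ pick u∈C (refl ∷ ++⁺ˡ P (refl ∷ s))
  go : Obstructed a u R → Has (m ∷ (a ∷ C) ++ m ∷ P ++ a ∷ R)
  go (inj₁ (x , y , x≢y , x≢u , y≢u , x≢a , y≢a , s)) =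
    word (m ∷ a ∷ u ∷ x ∷ y ∷ []) (0 ∷ 1 ∷ 2 ∷ 0 ∷ 1 ∷ 3 ∷ 4 ∷ 3 ∷ 2 ∷ [])
      ((m≢a ∷ m≢u ∷ ∈⇒≢ (lookup s (here refl)) m∉R ∘ sym ∷ ∈⇒≢ (lookup s (there (here refl))) m∉R ∘
          sym ∷ []) ∷
       (a≢u ∷ x≢a ∘ sym ∷ y≢a ∘ sym ∷ []) ∷ (x≢u ∘ sym ∷ y≢u ∘ sym ∷ []) ∷ (x≢y ∷ []) ∷ [] ∷ [])
      (embed s)
  go (inj₂ (r , r≢u , r≢a , s)) =
    word (m ∷ a ∷ u ∷ r ∷ []) (0 ∷ 1 ∷ 2 ∷ 0 ∷ 1 ∷ 3 ∷ 1 ∷ 2 ∷ [])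
      ((m≢a ∷ m≢u ∷ ∈⇒≢ (lookup s (here refl)) m∉R ∘ sym ∷ []) ∷
       (a≢u ∷ r≢a ∘ sym ∷ []) ∷ (r≢u ∘ sym ∷ []) ∷ [] ∷ [])
      (embed s)

two-stacked : ∀ {m a u v C P R} → m ∉ a ∷ C → m ∉ P → a ∉ C → a ∉ P →
  v ∈ C → v ∈ R → u ∈ C ++ P → u ∈ R → u ≢ v → Has (m ∷ (a ∷ C) ++ m ∷ P ++ a ∷ R)
two-stacked {m} {a} {u} {v} {C} {P} {R} m∉C m∉P a∉C a∉P v∈C v∈R u∈ u∈R u≢v with ∈-++⁻ C u∈
... | inj₂ u∈P = subst Has (cong (λ W → m ∷ a ∷ C ++ m ∷ P ++ a ∷ W) (++-identityʳ R))
  (certificate-unique (m ∷ a ∷ v ∷ u ∷ [])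
    (((0 ∷ 1 ∷ []) ∷ []) ∷ ((2 ∷ []) ∷ []) ∷ ((0 ∷ []) ∷ []) ∷ ((3 ∷ []) ∷ []) ∷ ((1 ∷ []) ∷ []) ∷
        ((2 ∷ []) ∷ (3 ∷ []) ∷ []) ∷ [])
    ((m∉C ∘ here ∷ (λ { refl → m∉C (there v∈C) }) ∷ (λ { refl → m∉P u∈P }) ∷ []) ∷
     ((λ { refl → a∉C v∈C }) ∷ (λ { refl → a∉P u∈P }) ∷ []) ∷ (u≢v ∘ sym ∷ []) ∷ [] ∷ [])
    {(m ∷ a ∷ []) ∷ C ∷ [ m ] ∷ P ∷ [ a ] ∷ R ∷ []}
    ((⊆-refl ∷ []) ∷ (from∈ v∈C ∷ []) ∷ (⊆-refl ∷ []) ∷ (from∈ u∈P ∷ []) ∷ (⊆-refl ∷ []) ∷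
        (from∈ v∈R ∷ from∈ u∈R ∷ []) ∷ []))
... | inj₁ u∈C = subst Has (cong (λ W → m ∷ a ∷ C ++ m ∷ P ++ a ∷ W) (++-identityʳ R))
  (certificate-unique (m ∷ a ∷ v ∷ u ∷ [])
    (((0 ∷ 1 ∷ []) ∷ []) ∷ ((2 ∷ []) ∷ (3 ∷ []) ∷ []) ∷ ((0 ∷ []) ∷ []) ∷ ([] ∷ []) ∷
        ((1 ∷ []) ∷ []) ∷ ((2 ∷ []) ∷ (3 ∷ []) ∷ []) ∷ [])
    ((m∉C ∘ here ∷ (λ { refl → m∉C (there v∈C) }) ∷ (λ { refl → m∉C (there u∈C) }) ∷ []) ∷
     ((λ { refl → a∉C v∈C }) ∷ (λ { refl → a∉C u∈C }) ∷ []) ∷ (u≢v ∘ sym ∷ []) ∷ [] ∷ [])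
    {(m ∷ a ∷ []) ∷ C ∷ [ m ] ∷ P ∷ [ a ] ∷ R ∷ []}
    ((⊆-refl ∷ []) ∷ (from∈ v∈C ∷ from∈ u∈C ∷ []) ∷ (⊆-refl ∷ []) ∷ (minimum P ∷ []) ∷ (⊆-refl ∷ [])
        ∷ (from∈ v∈R ∷ from∈ u∈R ∷ []) ∷ []))

-- Gluing runs and the step for a nonempty stack

sortable-∷ : ∀ {a C R} → a ∉ C → a ∉ R → Sortable C R → Sortable (a ∷ C) R
sortable-∷ {a} {C} {R} a∉C a∉R run = subst₂ (λ S W → Run nothing S W []) (sym (unfold-reverse a C))
    (++-identityʳ R)
  (run-++ {D = [ a ]} {Q = []} run (begin (close (λ ()) (λ ()) stop))
    (λ { (inj₁ i) (here refl) → a∉C (reverse⁻ {xs = C} i) ; (inj₂ (inj₁ i)) (here refl) → a∉R i }) λ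
        _ ())

-- At a cut the stack can be reduced to `a` alone, and what remains is a new problem whose word
-- starts with `a`.
sortable-cut : ∀ {a C P₁ P₂ R} → a ∉ C → a ∉ P₁ → Cut a (C ++ P₁) (P₂ ++ R) →
  Sortable C P₁ → Sortable [] (a ∷ P₂ ++ a ∷ R) → Sortable (a ∷ C) ((P₁ ++ P₂) ++ a ∷ R)
sortable-cut {a} {C} {P₁} {P₂} {R} a∉C a∉P₁ cut run run′ =
  subst₂ (λ S W → Run nothing S W []) (sym (unfold-reverse a C)) (sym (++-assoc P₁ P₂ (a ∷ R)))
    (run-++ {D = [ a ]} run (after-push run′)
      (λ { i (here refl) → a∉ i refl }) λ i j → ⊥-elim (disjoint i j))
  where
  a∉ : ∀ {c} → Present nothing (reverse C) P₁ c → c ≢ a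
  a∉ (inj₁ i) refl = a∉C (reverse⁻ {xs = C} i)
  a∉ (inj₂ (inj₁ i)) refl = a∉P₁ i
  disjoint : ∀ {c} → Present nothing (reverse C) P₁ c → c ∉ P₂ ++ a ∷ R
  disjoint i j = cut (a∉ i) (old i) (either (∈-++⁻ P₂ j) ∈-++⁺ˡ
    λ { (here e) → ⊥-elim (a∉ i e) ; (there k) → ∈-++⁺ʳ P₂ k })
    where
    old : ∀ {c} → Present nothing (reverse C) P₁ c → c ∈ C ++ P₁
    old (inj₁ i) = ∈-++⁺ˡ (reverse⁻ {xs = C} i)
    old (inj₂ (inj₁ i)) = ∈-++⁺ʳ C i

-- If `a` takes part in the sandwich, as outer or inner colour, then some other colour precedes an
-- `a` in `A`; over the stacked `a` this is already an obstruction.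
obstructed : ∀ {a u A B} → a ≢ u → Sandwich u (a ∷ A) → Obstructed a u (A ++ u ∷ B)
obstructed {a} {u} {A} {B} a≢u (x , y , x≢y , x≢u , y≢u , refl ∷ s) =
  inj₂ (y , y≢u , x≢y ∘ sym , ++⁺ s (refl ∷ minimum B))
obstructed {a} {u} {A} {B} a≢u (x , y , x≢y , x≢u , y≢u , _ ∷ʳ s) with x ≟ a | y ≟ a
... | yes refl | _ = inj₂ (y , y≢u , x≢y ∘ sym , ++⁺ (∷ˡ⁻ s) (refl ∷ minimum B))
... | no x≢a | yes refl = inj₂ (x , x≢u , x≢a , ++⁺ (⊆-trans (refl ∷ refl ∷ minimum _) s)
    (refl ∷ minimum B))
... | no x≢a | no y≢a = inj₁ (x , y , x≢y , x≢u , y≢u , x≢a , y≢a , ++⁺ s (refl ∷ minimum B))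

-- Starting the output of `u` uncovers `a`, so the sock `a` just reached merges with it by `dup`.
-- What piles up before the last `u` becomes the stack of an instance of `Claim` framed by `u`.
finish : ∀ {a u C P R X n} → Claim n → length R ≤ n → a ≢ u → a ∉ C → a ∉ P → u ∈ R → u ∈ C ++ P →
  (∀ {c} → c ∈ C ++ P → c ∈ R → c ≡ u) → (C ++ P) ++ a ∷ R ⊆ X → Run nothing (reverse C) P [ u ] →
  (Sortable (a ∷ C) (P ++ a ∷ R) ⊎ Has X) ⊎ Obstructed a u R
finish {a} {u} {C} {P} {R} {X} {n} claim len a≢u a∉C a∉P u∈R u∈ only sub run with last R u∈R
... | A , B , refl , u∉B with pushing u [ a ] A ([] ∷ []) (λ { (here e) → a≢u (sym e) })
...   | inj₂ sandwich = inj₂ (obstructed a≢u sandwich)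
...   | inj₁ p = inj₁ (next (claim u C′ B len′
    (subst Unique (reverse-++ layers [ a ]) (unique-reverse unique)) u∉C′ u∉B))
  where
  open Pushed p
  C′ : SockOrdering
  C′ = a ∷ reverse layers
  rev : reverse C′ ≡ layers ++ [ a ]
  rev = trans (unfold-reverse a (reverse layers)) (cong (_++ [ a ]) (reverse-involutive layers))
  u∉C′ : u ∉ C′
  u∉C′ (here e) = a≢u (sym e)
  u∉C′ (there i) = fresh-u (reverse⁻ {xs = layers} i)
  len′ : length C′ + length B ≤ n
  len′ = ≤-trans (≤-trans (s≤s (+-mono-≤ (length-mono-≤ layers⊆) (≤-refl {length B})))
    (≤-reflexive (trans (sym (+-suc (length A) (length B))) (sym (length-++ A))))) len
  next : Sortable C′ B ⊎ Has (u ∷ C′ ++ u ∷ B) → Sortable (a ∷ C) (P ++ a ∷ A ++ u ∷ B) ⊎ Has X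
  next (inj₂ has) = inj₂ (has-mono (⊆-trans (pick u∈ (refl ∷ ++⁺ layers⊆ ⊆-refl)) sub) has)
  next (inj₁ run′) = inj₁ (subst (λ S → Run nothing S (P ++ a ∷ A ++ u ∷ B) [])
      (sym (unfold-reverse a C))
    (run-++ {D = [ a ]} run
      (begin (dup (resume (emit (close u∉layers u∉B (subst (λ S → Run nothing S B []) rev run′))))))
      (λ { i (here refl) → a∉ i refl }) λ i j → here (only (old i) (tail-∈ (a∉ i) j))))
    where
    u∉layers : u ∉ layers ++ [ a ]
    u∉layers i = either (∈-++⁻ layers i) fresh-u λ { (here e) → a≢u (sym e) }
    a∉ : ∀ {c} → Present nothing (reverse C) P c → c ≢ a
    a∉ (inj₁ i) refl = a∉C (reverse⁻ {xs = C} i)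
    a∉ (inj₂ (inj₁ i)) refl = a∉P i
    old : ∀ {c} → Present nothing (reverse C) P c → c ∈ C ++ P
    old (inj₁ i) = ∈-++⁺ˡ (reverse⁻ {xs = C} i)
    old (inj₂ (inj₁ i)) = ∈-++⁺ʳ C i
    tail-∈ : ∀ {c W} → c ≢ a → c ∈ a ∷ W → c ∈ W
    tail-∈ c≢a (here e) = ⊥-elim (c≢a e)
    tail-∈ c≢a (there i) = i

-- `Theorem (suc n)` may be assumed since its own step uses size `n` only. It serves where the size
-- need not drop: for an empty stack, and at a cut, where `a` returns to the front of the word.
claim-step : ∀ n → Claim n → Theorem n → Theorem (suc n) → Claim (suc n)
claim-step n claim theorem theorem⁺ m [] R len _ _ _ with theorem⁺ R len
... | inj₁ run = inj₁ run
... | inj₂ has = inj₂ (has-mono (m ∷ʳ m ∷ʳ ⊆-refl) has)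
claim-step n claim theorem theorem⁺ m (a ∷ C) R len (a∉ ∷ uC) m∉C m∉R with a ∈? R
... | no a∉R with claim m C R (s≤s⁻¹ len) uC (m∉C ∘ there) m∉R
...   | inj₁ run = inj₁ (sortable-∷ (λ i → All.lookup a∉ i refl) a∉R run)
...   | inj₂ has = inj₂ (has-mono (refl ∷ a ∷ʳ ⊆-refl) has)
claim-step n claim theorem theorem⁺ m (a ∷ C) R len (a∉ ∷ uC) m∉C m∉R | yes a∈R with first R a∈R
... | P , R′ , refl , a∉P with lastCut a C P R′
...   | inj₁ record { before = P₁ ; after = P₂ ; split = refl ; cut = cut }
  with claim m C P₁ len₁ uC (m∉C ∘ there) (m∉R ∘ ∈-++⁺ˡ ∘ ∈-++⁺ˡ) | theorem⁺ (a ∷ P₂ ++ a ∷ R′) len₂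
  where
  P₁≤ : length P₁ ≤ length ((P₁ ++ P₂) ++ a ∷ R′)
  P₁≤ = length-mono-≤ (++⁺ʳ (a ∷ R′) (++⁺ʳ P₂ (⊆-refl {x = P₁})))
  len₁ : length C + length P₁ ≤ n
  len₁ = ≤-trans (+-monoʳ-≤ (length C) P₁≤) (s≤s⁻¹ len)
  len₂ : suc (length (P₂ ++ a ∷ R′)) ≤ suc n
  len₂ = s≤s (≤-trans (length-mono-≤ (++⁺ (++⁺ˡ P₁ (⊆-refl {x = P₂})) (⊆-refl {x = a ∷ R′})))
    (≤-trans (m≤n+m _ (length C)) (s≤s⁻¹ len)))
...     | inj₂ has | _ = inj₂ (has-mono (refl ∷ a ∷ʳ ++⁺ (⊆-refl {x = C})
    (refl ∷ ++⁺ʳ (a ∷ R′) (++⁺ʳ P₂ ⊆-refl))) has)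
...     | inj₁ _ | inj₂ has = inj₂ (has-mono (m ∷ʳ refl ∷ ++⁺ˡ C
    (m ∷ʳ ++⁺ (++⁺ˡ P₁ (⊆-refl {x = P₂})) ⊆-refl)) has)
...     | inj₁ run | inj₁ run′ = inj₁ (sortable-cut (λ i → All.lookup a∉ i refl) (a∉P ∘ ∈-++⁺ˡ) cut
    run run′)
claim-step n claim theorem theorem⁺ m (a ∷ C) _ len (a∉ ∷ uC) m∉C m∉R | yes a∈R | P , R′ , refl ,
    a∉P | inj₂ noCuts
  = go (crossings C P R′ noCuts)
  where
  X : SockOrdering
  X = m ∷ (a ∷ C) ++ m ∷ P ++ a ∷ R′
  a∉C : a ∉ C
  a∉C i = All.lookup a∉ i refl
  m∉R′ : m ∉ R′
  m∉R′ = m∉R ∘ ∈-++⁺ʳ P ∘ there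
  sub : a ∷ C ++ P ++ a ∷ R′ ⊆ X
  sub = m ∷ʳ refl ∷ ++⁺ (⊆-refl {x = C}) (m ∷ʳ ⊆-refl)
  total : length C + (length P + suc (length R′)) ≤ n
  total = ≤-trans (≤-reflexive (cong (length C +_) (sym (length-++ P)))) (s≤s⁻¹ len)
  go : Crossings C P R′ → Sortable (a ∷ C) (P ++ a ∷ R′) ⊎ Has X
  go (stacked v∈C v∈R u∈ u∈R u≢v) =
    inj₂ (two-stacked m∉C (m∉R ∘ ∈-++⁺ˡ) a∉C a∉P v∈C v∈R u∈ u∈R u≢v)
  go (pushed P₁ P₂ refl none v∈R u∈P₂ u∈R u≢v) =
    inj₂ (has-mono sub (two-pushed P₁ P₂ a∉C a∉P noCuts none v∈R u∈P₂ u∈R u≢v))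
  go (one {u} u∈ u∈R only where′) = complete (Phase.phase n claim theorem u∈R a≢u (length P) C P
      ≤-refl
      (≤-trans (+-monoʳ-≤ (length C) (≤-trans (≤-reflexive (+-comm 1 (length P)))
        (+-monoʳ-≤ (length P) (s≤s z≤n)))) total)
      uC a∉C a∉P (Phase.outer m (m∉C ∘ there) (m∉R ∘ ∈-++⁺ˡ) (m∉C ∘ here) ⊆-refl) sub noCuts only)
    where
    a≢u : a ≢ u
    a≢u refl = either (∈-++⁻ C u∈) a∉C a∉P
    complete : Run nothing (reverse C) P [ u ] ⊎ Has X → Sortable (a ∷ C) (P ++ a ∷ R′) ⊎ Has X
    complete (inj₂ has) = inj₂ has
    complete (inj₁ run) with finish {X = X} claim
      (≤-trans (≤-trans (n≤1+n _) (≤-trans (m≤n+m _ (length P)) (m≤n+m _ (length C)))) total)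
      a≢u a∉C a∉P u∈R u∈ only
      (⊆-trans (a ∷ʳ ⊆-reflexive (++-assoc C P (a ∷ R′))) sub) run
    ... | inj₁ r = r
    ... | inj₂ obs = inj₂ (either where′
      (λ u∈C → obstructed-stacked m∉C m∉R′ a∉C u∈C obs)
      (λ (u∉C , u∈P) → has-mono sub (obstructed-pushed a∉C a∉P noCuts only u∈R u∉C u∈P obs)))

-- Outputting or keeping the first sock

before-last : ∀ {m : Color} ws V {W} → ws ++ [ m ] ⊆ V ++ m ∷ W → m ∉ W → ws ⊆ V
before-last [] V s m∉ = minimum V
before-last (w ∷ ws) [] (refl ∷ s) m∉ = ⊥-elim (m∉ (lookup s (middle ws)))
before-last (w ∷ ws) [] (_ ∷ʳ s) m∉ = ⊥-elim (m∉ (lookup s (there (middle ws))))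
before-last (w ∷ ws) (v ∷ V) (refl ∷ s) m∉ = refl ∷ before-last ws V s m∉
before-last (w ∷ ws) (v ∷ V) (_ ∷ʳ s) m∉ = v ∷ʳ before-last (w ∷ ws) V s m∉

-- If `b` recurs between the second and the last `m`, the orders of `b`, `u` and `m` alone give
-- seven-letter patterns. Otherwise the sandwich, which ends before the last `m`, enters a template
-- with `Z` extending up to that `m`.
two-crossing : ∀ {m b u x y P R} → m ≢ b → m ≢ u → b ≢ u → m ≢ x → m ≢ y → x ≢ y →
  x ∷ y ∷ x ∷ m ∷ [] ⊆ b ∷ P ++ m ∷ R → u ∈ P → b ∈ R → u ∈ R → Has (m ∷ b ∷ P ++ m ∷ R)
two-crossing {m} {b} {u} {x} {y} {P} {R} mb mu bu mx my xy s u∈P b∈R u∈R with m ∈? R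
... | no m∉R = go (before-last (x ∷ y ∷ x ∷ []) (b ∷ P) s m∉R)
  where
  go : x ∷ y ∷ x ∷ [] ⊆ b ∷ P → Has (m ∷ b ∷ P ++ m ∷ R)
  go (refl ∷ s′) = crossing-sandwich′ mb mu bu my xy u∈P s′ b∈R u∈R
  go (_ ∷ʳ s′) = crossing-sandwich mb mu bu mx my xy u∈P s′ b∈R u∈R
... | yes m∈R with last R m∈R
...   | A , W , refl , m∉W with b ∈? A
...     | yes b∈A with ∈-∃++ b∈A
...       | A₁ , A₂ , refl = go (∈-++⁻ A₁ (subst (u ∈_) (++-assoc A₁ (b ∷ A₂) (m ∷ W)) u∈R))
  where
  distinct : Unique (m ∷ b ∷ u ∷ [])
  distinct = (mb ∷ mu ∷ []) ∷ (bu ∷ []) ∷ [] ∷ []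
  go : u ∈ A₁ ⊎ u ∈ b ∷ A₂ ++ m ∷ W → Has (m ∷ b ∷ P ++ m ∷ (A₁ ++ b ∷ A₂) ++ m ∷ W)
  go (inj₁ i) = word (m ∷ b ∷ u ∷ []) (0 ∷ 1 ∷ 2 ∷ 0 ∷ 2 ∷ 1 ∷ 0 ∷ []) distinct
    (refl ∷ refl ∷ pick u∈P (refl ∷ ++⁺ (pick i (refl ∷ minimum A₂)) (refl ∷ minimum W)))
  go (inj₂ (here e)) = ⊥-elim (bu (sym e))
  go (inj₂ (there i)) with ∈-++⁻ A₂ i
  ... | inj₁ j = word (m ∷ b ∷ u ∷ []) (0 ∷ 1 ∷ 2 ∷ 0 ∷ 1 ∷ 2 ∷ 0 ∷ []) distinct
    (refl ∷ refl ∷ pick u∈P (refl ∷ ++⁺ (++⁺ˡ A₁ (refl ∷ from∈ j)) (refl ∷ minimum W)))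
  ... | inj₂ (here e) = ⊥-elim (mu (sym e))
  ... | inj₂ (there j) = word (m ∷ b ∷ u ∷ []) (0 ∷ 1 ∷ 2 ∷ 0 ∷ 1 ∷ 0 ∷ 2 ∷ []) distinct
    (refl ∷ refl ∷ pick u∈P (refl ∷ ++⁺ (from∈ (middle A₁)) (refl ∷ from∈ j)))
two-crossing {m} {b} {u} {x} {y} {P} mb mu bu mx my xy s u∈P b∈R u∈R
  | yes m∈R | A , W , refl , m∉W | no b∉A =
  subst Has (cong (λ V → m ∷ b ∷ V) (++-assoc P (m ∷ A) (m ∷ W)))
    (go (before-last (x ∷ y ∷ x ∷ []) (b ∷ P ++ m ∷ A)
      (subst (x ∷ y ∷ x ∷ m ∷ [] ⊆_) (cong (b ∷_) (sym (++-assoc P (m ∷ A) (m ∷ W)))) s) m∉W)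
          (∈-++⁻ A u∈R))
  where
  b∈W : b ∈ W
  b∈W with ∈-++⁻ A b∈R
  ... | inj₁ i = ⊥-elim (b∉A i)
  ... | inj₂ (here e) = ⊥-elim (mb (sym e))
  ... | inj₂ (there i) = i
  go : x ∷ y ∷ x ∷ [] ⊆ b ∷ P ++ m ∷ A → u ∈ A ⊎ u ∈ m ∷ W → Has (m ∷ b ∷ (P ++ m ∷ A) ++ m ∷ W)
  go (refl ∷ s′) (inj₁ u∈A) = repeated-sandwich′ mb mu bu my xy (pick u∈P (refl ∷ from∈ u∈A)) s′ b∈W
  go (_ ∷ʳ s′) (inj₁ u∈A) = repeated-sandwich mb mu bu mx my xy (pick u∈P (refl ∷ from∈ u∈A)) s′ b∈W
  go _ (inj₂ (here e)) = ⊥-elim (mu (sym e))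
  go (refl ∷ s′) (inj₂ (there u∈W)) = crossing-sandwich′ mb mu bu my xy (∈-++⁺ˡ u∈P) s′ b∈W u∈W
  go (_ ∷ʳ s′) (inj₂ (there u∈W)) = crossing-sandwich mb mu bu mx my xy (∈-++⁺ˡ u∈P) s′ b∈W u∈W

module _ (n : ℕ) (claim : Claim n) (theorem : Theorem n) where

  -- The sandwich xyx prevents m from being output first, so it is kept on the stack.
  hold-first : ∀ {m x y} Y → length Y ≤ n → m ∈ Y → m ≢ x → m ≢ y → x ≢ y →
    x ∷ y ∷ x ∷ m ∷ [] ⊆ Y → Sortable [] (m ∷ Y) ⊎ Has (m ∷ Y)
  hold-first {m} Y len m∈Y m≢x m≢y x≢y s with first Y m∈Y
  -- Two leading socks `m` act as one, since stacks are contracted.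
  ... | [] , R , refl , _ with theorem (m ∷ R) len
  ...   | inj₁ run = inj₁ (push (λ ()) (dup (after-push run)))
  ...   | inj₂ has = inj₂ (has-mono (m ∷ʳ ⊆-refl) has)
  hold-first {m} Y len m∈Y m≢x m≢y x≢y s | b ∷ P , R , refl , m∉bP with lastCut m [ b ] P R
  ... | inj₁ record { before = P₁ ; after = P₂ ; split = refl ; cut = cut }
    with theorem (b ∷ P₁) (≤-trans (length-mono-≤ (++⁺ʳ (m ∷ R) (++⁺ʳ P₂ (⊆-refl {x = b ∷ P₁}))))
        len)
       | theorem (m ∷ P₂ ++ m ∷ R) (≤-trans (s≤s
           (length-mono-≤ (++⁺ (++⁺ˡ P₁ (⊆-refl {x = P₂})) (⊆-refl {x = m ∷ R})))) len)
  ...   | inj₂ has | _ = inj₂ (has-mono (m ∷ʳ ++⁺ʳ (m ∷ R) (++⁺ʳ P₂ (⊆-refl {x = b ∷ P₁}))) has)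
  ...   | inj₁ _ | inj₂ has = inj₂ (has-mono (refl ∷ b ∷ʳ ++⁺ (++⁺ˡ P₁ (⊆-refl {x = P₂})) ⊆-refl)
      has)
  ...   | inj₁ run | inj₁ run′ = inj₁ (push (λ ())
      (sortable-cut {C = []} (λ ()) (λ i → m∉bP (weaken i)) cut run run′))
    where
    weaken : ∀ {c} → c ∈ b ∷ P₁ → c ∈ b ∷ P₁ ++ P₂
    weaken = ∈-++⁺ˡ
  hold-first {m} {x} {y} Y len m∈Y m≢x m≢y x≢y s | b ∷ P , R , refl , m∉bP | inj₂ noCuts =
    go (crossings [ b ] P R noCuts)
    where
    X : SockOrdering
    X = m ∷ b ∷ P ++ m ∷ R
    m≢b : m ≢ b
    m≢b = m∉bP ∘ here
    m∉b : m ∉ [ b ]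
    m∉b (here e) = m≢b e
    total : suc (length P + suc (length R)) ≤ n
    total = ≤-trans (≤-reflexive (cong suc (sym (length-++ P)))) len
    enclosed : Obstructed m b R → x ∷ y ∷ x ∷ m ∷ [] ⊆ b ∷ P ++ m ∷ R → Has X
    enclosed obs (refl ∷ s′) = nested-sandwich′ {P = P} m≢b m≢y x≢y obs s′
    enclosed obs (_ ∷ʳ s′) = nested-sandwich {P = P} m≢b m≢x m≢y x≢y obs s′
    go : Crossings [ b ] P R → Sortable [] X ⊎ Has X
    go (stacked (here refl) b∈R (here e) u∈R u≢b) = ⊥-elim (u≢b e)
    go (stacked (here refl) b∈R (there u∈P) u∈R u≢b) =
      inj₂ (two-crossing m≢b (λ { refl → m∉bP (there u∈P) }) (u≢b ∘ sym) m≢x m≢y x≢y s u∈P b∈R u∈R)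
    go (pushed P₁ P₂ refl none v∈R u∈P₂ u∈R u≢v) =
      inj₂ (two-pushed P₁ P₂ m∉b (m∉bP ∘ there) noCuts none v∈R u∈P₂ u∈R u≢v)
    go (one {u} u∈ u∈R only where′) = complete
        (Phase.phase n claim theorem u∈R m≢u (length P) [ b ] P ≤-refl
        (≤-trans (s≤s (≤-trans (≤-reflexive (+-comm 1 (length P)))
            (+-monoʳ-≤ (length P) (s≤s z≤n)))) total)
        ([] ∷ []) m∉b (m∉bP ∘ there) (Phase.single refl) ⊆-refl noCuts only)
      where
      m≢u : m ≢ u
      m≢u refl = m∉bP u∈
      complete : Run nothing [ b ] P [ u ] ⊎ Has X → Sortable [] X ⊎ Has X
      complete (inj₂ has) = inj₂ has
      complete (inj₁ run) with finish {X = X} claim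
        (≤-trans (n≤1+n _) (≤-trans (m≤n+m _ (length P)) (≤-trans (n≤1+n _) total)))
        m≢u m∉b (m∉bP ∘ there) u∈R u∈ only (m ∷ʳ ⊆-refl) run
      ... | inj₁ (inj₁ run′) = inj₁ (push (λ ()) (push (λ { (here e) → m≢b (sym e) }) run′))
      ... | inj₁ (inj₂ has) = inj₂ has
      -- When `u` is the stacked `b`, there is no frame around it; the sandwich that forced `m` to
      -- be kept takes over that part.
      ... | inj₂ obs = inj₂ (either where′ (λ { (here refl) → enclosed obs s })
        (λ (u∉C , u∈P) → obstructed-pushed m∉b (m∉bP ∘ there) noCuts only u∈R u∉C u∈P obs))

  theorem-step : Theorem (suc n)
  theorem-step [] _ = inj₁ stop
  theorem-step (m ∷ Y) (s≤s len) with m ∈? Y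
  ... | no m∉Y with theorem Y len
  ...   | inj₁ run = inj₁ (push (λ ()) (sortable-∷ {C = []} (λ ()) m∉Y run))
  ...   | inj₂ has = inj₂ (has-mono (m ∷ʳ ⊆-refl) has)
  theorem-step (m ∷ Y) (s≤s len) | yes m∈Y with last Y m∈Y
  ... | A , B , refl , m∉B with pushing m [] A [] (λ ())
  ...   | inj₂ (x , y , x≢y , x≢m , y≢m , s) =
    hold-first (A ++ m ∷ B) len m∈Y (x≢m ∘ sym) (y≢m ∘ sym) x≢y (++⁺ s (refl ∷ minimum B))
  ...   | inj₁ p with claim m (reverse layers) B len′ unique′ m∉ m∉B
    where
    open Pushed p
    len′ : length (reverse layers) + length B ≤ n
    len′ = ≤-trans (≤-trans (+-mono-≤ (length-mono-≤ layers⊆) (n≤1+n (length B)))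
      (≤-reflexive (sym (length-++ A)))) len
    unique′ : Unique (reverse layers)
    unique′ = unique-reverse (subst Unique (++-identityʳ layers) unique)
    m∉ : m ∉ reverse layers
    m∉ i = fresh-u (reverse⁻ {xs = layers} i)
  ...     | inj₂ has = inj₂ (has-mono (refl ∷ ++⁺ layers⊆ ⊆-refl) has)
    where open Pushed p
  ...     | inj₁ run = inj₁ (push (λ ()) (begin (resume (emit (close m∉layers m∉B
              (subst (λ S → Run nothing S B []) rev run))))))
    where
    open Pushed p
    rev : reverse (reverse layers) ≡ layers ++ []
    rev = trans (reverse-involutive layers) (sym (++-identityʳ layers))
    m∉layers : m ∉ layers ++ []
    m∉layers i = fresh-u (subst (m ∈_) (++-identityʳ layers) i)

all-sizes : ∀ n → Claim n × Theorem n
all-sizes zero = (λ { m [] [] _ _ _ _ → inj₁ stop }) , λ { [] _ → inj₁ stop }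
all-sizes (suc n) with all-sizes n
... | claim , theorem = claim-step n claim theorem theorem⁺ , theorem⁺
  where
  theorem⁺ : Theorem (suc n)
  theorem⁺ = theorem-step n claim theorem

theorem1p1 : (X : SockOrdering) → ¬ FootSortable X →
    Σ SockOrdering (λ Z → (Z ⊆ X) × InΓ Z)
theorem1p1 X unsortable with proj₂ (all-sizes (length X)) X ≤-refl
... | inj₁ run = ⊥-elim (unsortable (run-sortable run))
... | inj₂ has = has
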